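{- Let $\mathbb{A}=(Q,\Sigma,\beta,Q_{in},\delta,F)$ be a Büchi word constraint automaton involving the constants $d_1<\dots<d_\alpha$. There is a deterministic Rabin word constraint automaton $\mathbb{A}'=(Q',\Sigma,\beta,Q'_{in},\delta',\mathcal{F})$ with $L(\mathbb{A})=L(\mathbb{A}')$ such that: (I) $|Q'|$ is exponential in $|Q|$ and the number of Rabin pairs of $\mathbb{A}'$ is bounded by $2\cdot|Q|$; (II) the constraints in the transitions of $\mathbb{A}'$ are from $\mathrm{SatTypes}(\beta)$, are of size cubic in $\beta+\max(\lceil\log|d_1|\rceil,\lceil\log|d_\alpha|\rceil)$, and $|\delta'|\le|Q'|^2\times|\Sigma|\times((d_\alpha-d_1)+3)^{2\beta}3^{2\beta^2}$.
   Context: Constraints are Boolean combinations of atomic constraints $t<t'$, $t=t'$, $t=d$ ($d\in\mathbb{Z}$) over terms $x_1,\dots,x_\beta,x'_1,\dots,x'_\beta$. A Büchi word constraint automaton $(Q,\Sigma,\beta,Q_{in},\delta,F)$ has finite locations $Q$, finite alphabet $\Sigma$, initial set $Q_{in}$, accepting set $F$, and a finite set $\delta$ of transitions $(q,a,\Theta,q')$ with $\Theta$ such a constraint; it accepts $w:\mathbb{N}\to\Sigma\times\mathbb{Z}^\beta$, $w(i)=(a_i,z_i)$, if there is a sequence of transitions $(q_i,a_i,\Theta_i,q_{i+1})\in\delta$ with $q_0\in Q_{in}$, $\Theta_i$ true under $x_j\mapsto z_i(j)$, $x'_j\mapsto z_{i+1}(j)$, and some location of $F$ occurring infinitely often. A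 Rabin word constraint automaton instead has a set $\mathcal{F}$ of pairs $(L,U)$ of subsets of locations, and a run is accepting if for some pair, $L$ is visited infinitely often and $U$ only finitely often. An automaton is deterministic if for every location $q$, letter $a$ and $(z,z')\in\mathbb{Z}^{2\beta}$ there is at most one transition $(q,a,\Theta,q')$ with $\Theta$ true under $x_j\mapsto z(j),x'_j\mapsto z'(j)$. A type over variables $z_1,\dots,z_n$ is a conjunction $\bigwedge_i\Theta_i^{CST}\wedge\bigwedge_{i<j}z_i\sim_{i,j}z_j$ with $\sim_{i,j}\in\{<,=,>\}$ and each $\Theta_i^{CST}$ one of $z_i<d_1$, $z_i>d_\alpha$, or $z_i=d$ for some $d\in[d_1,d_\alpha]$; $\mathrm{SatTypes}(\beta)$ is the set of satisfiable types over the $2\beta$ variables $x_1,\dots,x_\beta,x'_1,\dots,x'_\beta$. -}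

module Defs where

open import Data.Nat as ℕ using (ℕ; zero; suc; _+_; _*_; _^_; _≤_; _<_; _⊔_)
open import Data.Nat.Logarithm using (⌈log₂_⌉)
open import Data.Integer as ℤ using (ℤ; ∣_∣)
open import Data.Bool using (Bool; true; false; _∧_; _∨_; not; T; if_then_else_)
open import Data.Fin as Fin using (Fin; toℕ; splitAt)
open import Data.Fin.Base using () renaming (_<_ to _<ᶠ_)
open import Data.Vec as Vec using (Vec; lookup; head; last; toList)
open import Data.List as List using (List; []; _∷_; _++_; concatMap; allFin; length; foldr)
open import Data.List.Membership.Propositional using (_∈_)
open import Data.Product using (Σ; ∃; ∃-syntax; _×_; _,_)
open import Data.Sum using (inj₁; inj₂)
open import Relation.Binary.PropositionalEquality using (_≡_)
open import Relation.Nullary using (Dec; yes; no)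
open import Relation.Nullary.Decidable using (⌊_⌋)

_<ᵇℤ_ : ℤ → ℤ → Bool
a <ᵇℤ b = ⌊ a ℤ.<? b ⌋

_≡ᵇℤ_ : ℤ → ℤ → Bool
a ≡ᵇℤ b = ⌊ a ℤ.≟ b ⌋
open import Function.Bundles using (_⇔_)

data Term (β : ℕ) : Set where
  x  : Fin β → Term β     -- x_j  (current value)
  x' : Fin β → Term β     -- x'_j (next value)

-- Boolean combinations of atomic constraints.
-- Atoms t<t', t=t', t=d are the paper's atoms; the atoms t<d and t>d
-- are additionally needed to write the conjuncts z_i<d_1, z_i>d_α of types.
data Constraint (β : ℕ) : Set where
  tt   : Constraint β
  ff   : Constraint β
  lt   : Term β → Term β → Constraint β
  eq   : Term β → Term β → Constraint β
  eqc  : Term β → ℤ → Constraint β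
  ltc  : Term β → ℤ → Constraint β
  gtc  : Term β → ℤ → Constraint β
  neg  : Constraint β → Constraint β
  _&_  : Constraint β → Constraint β → Constraint β
  _∣∣_ : Constraint β → Constraint β → Constraint β

Basic : ∀ {β} → Constraint β → Set
Basic (ltc _ _) = Data.Empty.⊥ where import Data.Empty
Basic (gtc _ _) = Data.Empty.⊥ where import Data.Empty
Basic (neg φ) = Basic φ
Basic (φ & ψ) = Basic φ × Basic ψ
Basic (φ ∣∣ ψ) = Basic φ × Basic ψ
Basic _ = Data.Unit.⊤ where import Data.Unit

evalT : ∀ {β} → Vec ℤ β → Vec ℤ β → Term β → ℤ
evalT z z' (x j)  = lookup z j
evalT z z' (x' j) = lookup z' j

eval : ∀ {β} → Constraint β → Vec ℤ β → Vec ℤ β → Bool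
eval tt z z' = true
eval ff z z' = false
eval (lt t u) z z' = evalT z z' t <ᵇℤ evalT z z' u
eval (eq t u) z z' = evalT z z' t ≡ᵇℤ evalT z z' u
eval (eqc t d) z z' = evalT z z' t ≡ᵇℤ d
eval (ltc t d) z z' = evalT z z' t <ᵇℤ d
eval (gtc t d) z z' = d <ᵇℤ evalT z z' t
eval (neg φ) z z' = not (eval φ z z')
eval (φ & ψ) z z' = eval φ z z' ∧ eval ψ z z'
eval (φ ∣∣ ψ) z z' = eval φ z z' ∨ eval ψ z z'

consts : ∀ {β} → Constraint β → List ℤ
consts (eqc _ d) = d ∷ []
consts (ltc _ d) = d ∷ []
consts (gtc _ d) = d ∷ []
consts (neg φ) = consts φ
consts (φ & ψ) = consts φ ++ consts ψ
consts (φ ∣∣ ψ) = consts φ ++ consts ψ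
consts _ = []

bitsize : ℤ → ℕ
bitsize d = suc ⌈log₂ (suc ∣ d ∣) ⌉

size : ∀ {β} → Constraint β → ℕ
size tt = 1
size ff = 1
size (lt _ _) = 3
size (eq _ _) = 3
size (eqc _ d) = 2 + bitsize d
size (ltc _ d) = 2 + bitsize d
size (gtc _ d) = 2 + bitsize d
size (neg φ) = suc (size φ)
size (φ & ψ) = suc (size φ + size ψ)
size (φ ∣∣ ψ) = suc (size φ + size ψ)

var : ∀ {β} → Fin (β + β) → Term β
var {β} i with splitAt β i
... | inj₁ j = x j
... | inj₂ j = x' j

data CST : Set where
  below : CST
  above : CST
  equal : ℤ → CST

data Ord : Set where
  lt< eq= gt> : Ord

record Type (β : ℕ) : Set where
  field
    cst : Fin (β + β) → CST
    rel : Fin (β + β) → Fin (β + β) → Ord   -- used only for i < j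

WFType : ∀ {β} → ℤ → ℤ → Type β → Set
WFType dmin dmax τ = ∀ i d → Type.cst τ i ≡ equal d → dmin ℤ.≤ d × d ℤ.≤ dmax

cstC : ∀ {β} → ℤ → ℤ → Term β → CST → Constraint β
cstC dmin dmax t below = ltc t dmin
cstC dmin dmax t above = gtc t dmax
cstC dmin dmax t (equal d) = eqc t d

relC : ∀ {β} → Term β → Term β → Ord → Constraint β
relC t u lt< = lt t u
relC t u eq= = eq t u
relC t u gt> = lt u t

conj : ∀ {β} → List (Constraint β) → Constraint β
conj = foldr _&_ tt

typeConstraint : ∀ {β} → ℤ → ℤ → Type β → Constraint β
typeConstraint {β} dmin dmax τ =
  conj (List.map (λ i → cstC dmin dmax (var i) (Type.cst τ i)) (allFin (β + β)))
  & conj (concatMap (λ i → concatMap (λ j → if toℕ i ℕ.<ᵇ toℕ j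
                                               then relC (var i) (var j) (Type.rel τ i j) ∷ []
                                               else []) (allFin (β + β))) (allFin (β + β)))

Satisfiable : ∀ {β} → Constraint β → Set
Satisfiable Θ = ∃[ z ] ∃[ z' ] T (eval Θ z z')

InSatTypes : ∀ {β} → ℤ → ℤ → Constraint β → Set
InSatTypes {β} dmin dmax Θ =
  Σ (Type β) λ τ → WFType dmin dmax τ × Θ ≡ typeConstraint dmin dmax τ × Satisfiable Θ

record Trans (nQ s β : ℕ) : Set where
  constructor trans
  field
    src : Fin nQ
    lab : Fin s
    con : Constraint β
    tgt : Fin nQ

record CA (s β : ℕ) : Set where
  field
    nQ   : ℕ
    init : Fin nQ → Bool
    δ    : List (Trans nQ s β)

record Buchi (s β : ℕ) : Set where
  field
    aut : CA s β
    acc : Fin (CA.nQ aut) → Bool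

record Rabin (s β : ℕ) : Set where
  field
    aut   : CA s β
    pairs : List ((Fin (CA.nQ aut) → Bool) × (Fin (CA.nQ aut) → Bool))

Word : ℕ → ℕ → Set
Word s β = ℕ → Fin s × Vec ℤ β

letter : ∀ {s β} → Word s β → ℕ → Fin s
letter w i = Data.Product.proj₁ (w i) where import Data.Product
vals : ∀ {s β} → Word s β → ℕ → Vec ℤ β
vals w i = Data.Product.proj₂ (w i) where import Data.Product

record Run {s β} (A : CA s β) (w : Word s β) : Set where
  field
    ρ      : ℕ → Trans (CA.nQ A) s β
    inδ    : ∀ i → ρ i ∈ CA.δ A
    start  : T (CA.init A (Trans.src (ρ 0)))
    chain  : ∀ i → Trans.tgt (ρ i) ≡ Trans.src (ρ (suc i))
    label  : ∀ i → Trans.lab (ρ i) ≡ letter w i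
    sat    : ∀ i → T (eval (Trans.con (ρ i)) (vals w i) (vals w (suc i)))

  loc : ℕ → Fin (CA.nQ A)
  loc i = Trans.src (ρ i)

InfOften : ∀ {n} → (ℕ → Fin n) → (Fin n → Bool) → Set
InfOften q S = ∀ n → ∃[ m ] (n ≤ m × T (S (q m)))

FinOften : ∀ {n} → (ℕ → Fin n) → (Fin n → Bool) → Set
FinOften q S = ∃[ n ] ∀ m → n ≤ m → T (not (S (q m)))

AcceptsB : ∀ {s β} → Buchi s β → Word s β → Set
AcceptsB B w = Σ (Run (Buchi.aut B) w) λ r → InfOften (Run.loc r) (Buchi.acc B)

AcceptsR : ∀ {s β} → Rabin s β → Word s β → Set
AcceptsR R w = Σ (Run (Rabin.aut R) w) λ r →
  ∃[ LU ] (LU ∈ Rabin.pairs R ×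
           InfOften (Run.loc r) (Data.Product.proj₁ LU) ×
           FinOften (Run.loc r) (Data.Product.proj₂ LU))
  where import Data.Product

SameLanguage : ∀ {s β} → Buchi s β → Rabin s β → Set
SameLanguage B R = ∀ w → AcceptsB B w ⇔ AcceptsR R w

Deterministic : ∀ {s β} → CA s β → Set
Deterministic {s} {β} A = ∀ (t u : Trans (CA.nQ A) s β) → t ∈ CA.δ A → u ∈ CA.δ A →
  (z z' : Vec ℤ β) → Trans.src t ≡ Trans.src u → Trans.lab t ≡ Trans.lab u →
  T (eval (Trans.con t) z z') → T (eval (Trans.con u) z z') → t ≡ u

Involves : ∀ {s β k} → Vec ℤ (suc k) → CA s β → Set
Involves ds A = ∀ t → t ∈ CA.δ A →
  Basic (Trans.con t) × (∀ d → d ∈ consts (Trans.con t) → d ∈ toList ds)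

StrictlyIncreasing : ∀ {k} → Vec ℤ k → Set
StrictlyIncreasing ds = ∀ i j → i <ᶠ j → lookup ds i ℤ.< lookup ds j

paramN : ℕ → ℤ → ℤ → ℕ
paramN β dmin dmax = β + (⌈log₂ ∣ dmin ∣ ⌉ ⊔ ⌈log₂ ∣ dmax ∣ ⌉)

module Submission where

-- Each constraint is decided by the type of (z , z'), so a transition of the new automaton is
-- labelled by a type and its target is computed from the edge relation that this type induces on
-- the locations of A. What remains is to determinise a Büchi automaton over edge relations.
--
-- Order the reachable locations by their best history, where visiting F early is better; this
-- yields an ordered list of slices. A slice splits into its successors in F followed by the other
-- ones, and a location is kept only in its first slice. A slice boundary is the set P of all
-- locations up to it, and simply evolves to post P. The state is the list of boundaries in order
-- of age: boundaries that become equal are merged into the oldest one. As boundaries form a chain,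
-- there are at most n nonempty ones. A position is bad when its boundary is not the image of the
-- previous boundary at this position, and green when the slice ending at it has no successors
-- outside F, so that the boundary moves left past a turn into F. A word is accepted iff some
-- position is green infinitely often and bad finitely often.
--
-- For an accepting run, take a boundary X above the run: its age settles at a position. If this
-- position is eventually never green, the last slice of X has successors outside F at every step,
-- and a boundary born when the run next visits F stays strictly below X; induct on the
-- cardinality. Conversely, given a stable position X green infinitely often, take the last infinite
-- branch of slices below X: were it to avoid F, X would eventually stay at its right end and never
-- be green again. Breakpoints and König's lemma turn this branch into an accepting run.

open import Defs
open import Level using (0ℓ)
open import Axiom.ExcludedMiddle using (ExcludedMiddle)
open import Data.Bool using (Bool; true; false; T; not; _∧_; _∨_; if_then_else_)
import Data.Bool.Properties as Boolₚ
open import Data.Empty using (⊥; ⊥-elim)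
open import Data.Fin using (Fin; zero; suc; toℕ; fromℕ; fromℕ<; combine; remQuot; _↑ˡ_; _↑ʳ_)
import Data.Fin.Properties as Finₚ
open import Data.Fin.Subset using (Subset; Nonempty; _⊆_; _⊂_)
  renaming (_∈_ to _∈ₛ_; _∉_ to _∉ₛ_; ∣_∣ to card; ⊥ to ∅)
open import Data.Fin.Subset.Properties
  using (p⊂q⇒∣p∣<∣q∣; ∣p∣≤n; ∉⊥; ⊥⊆; ⊆-refl; ⊆-reflexive; ⊆-trans; ⊆-antisym; ⊂-⊆-trans; ⊆-⊂-trans)
open import Data.Integer using (ℤ; ∣_∣; _-_; +_; -[1+_]; +≤+; -≤-)
import Data.Integer as ℤ
import Data.Integer.Properties as ℤₚ
open import Data.List using (List; []; _∷_; _++_; length; filter; deduplicate; allFin; upTo;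
  concatMap; mapMaybe; cartesianProductWith; cartesianProduct)
import Data.List as List
import Data.List.Properties as Listₚ
open import Data.List.Membership.Propositional using (_∈_)
open import Data.List.Membership.Propositional.Properties
  using (∈-lookup; ∈-++⁻; ∈-++⁺ˡ; ∈-++⁺ʳ; ∈-deduplicate⁻; ∈-map⁺; ∈-map⁻; ∈-upTo⁺; ∈-upTo⁻; ∈-allFin;
         ∈-cartesianProductWith⁺; ∈-cartesianProductWith⁻; ∈-cartesianProduct⁺; ∈-cartesianProduct⁻)
open import Data.List.Relation.Unary.All as All using (All; []; _∷_)
import Data.List.Relation.Unary.All.Properties as Allₚ
open import Data.List.Relation.Unary.AllPairs using (_∷_)
open import Data.List.Relation.Unary.Any using (here; there)
open import Data.List.Relation.Unary.Unique.Propositional using (Unique)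
import Data.List.Relation.Unary.Unique.DecPropositional.Properties as Uniqueₚ
open import Data.Maybe using (Maybe; just; nothing)
open import Data.Maybe.Properties using (just-injective)
open import Data.Nat as ℕ using (ℕ; zero; suc; _+_; _*_; _^_; _∸_; _≤_; _<_; _⊔_;
  z≤n; s≤s; _≤?_; ≤′-refl; ≤′-step)
open import Data.Nat.Logarithm using (⌈log₂_⌉; ⌈log₂⌉-mono-≤; ⌈log₂2*n⌉≡1+⌈log₂n⌉)
import Data.Nat.Properties as ℕₚ
open import Data.Nat.Tactic.RingSolver using (solve-∀)
open import Data.Product using (Σ; ∃; ∃-syntax; _×_; _,_; proj₁; proj₂)
open import Data.Sum using (_⊎_; inj₁; inj₂)
open import Data.Unit using (⊤)
open import Data.Vec using (Vec; []; _∷_; head; last; lookup; tabulate; toList; map)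
open import Data.Vec.Membership.Propositional.Properties using () renaming (∈-toList⁻ to ∈-toList⇒∈)
import Data.Vec.Properties as Vecₚ
import Data.Vec.Relation.Unary.Any as VecAny
import Data.Vec.Relation.Unary.Any.Properties as VecAnyₚ
open import Function using (_∘_)
open import Function.Bundles using (_⇔_; mk⇔; Equivalence)
open import Relation.Binary.Definitions using (DecidableEquality; tri<; tri≈; tri>)
open import Relation.Binary.PropositionalEquality hiding (trans)
import Relation.Binary.PropositionalEquality as ≡
open import Relation.Nullary using (Dec; yes; no; ¬_; ¬?)
open import Relation.Nullary.Decidable
  using (⌊_⌋; toWitness; fromWitness; decidable-stable; isYes≗does; dec-true; dec-false)
open import Relation.Unary using (Pred; Decidable)

-- Classical principles

climb : ∀ {P : ℕ → Set} {m} → P m → (∀ i → m ≤ i → P i → P (suc i)) → ∀ i → m ≤ i → P i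
climb {P} {m} base step i m≤i = go (ℕₚ.≤⇒≤′ m≤i)
  where
  go : ∀ {i} → m ℕ.≤′ i → P i
  go ≤′-refl = base
  go (≤′-step p) = step _ (ℕₚ.≤′⇒≤ p) (go p)

eventually-all : ∀ {m} (P : Fin m → ℕ → Set) → (∀ j {a b} → a ≤ b → P j a → P j b) →
  (∀ j → ∃ (P j)) → ∃ λ b → ∀ j → P j b
eventually-all {zero} P mono ex = 0 , λ ()
eventually-all {suc m} P mono ex
  with ex zero | eventually-all (λ j → P (suc j)) (λ j → mono (suc j)) (λ j → ex (suc j))
... | a , pa | b , pb = a ⊔ b , λ where
  zero    → mono zero (ℕₚ.m≤m⊔n a b) pa
  (suc j) → mono (suc j) (ℕₚ.m≤n⊔m a b) (pb j)

module Classical (em : ExcludedMiddle 0ℓ) where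

  stable : ∀ {P : Set} → ¬ ¬ P → P
  stable = decidable-stable em

  ¬∀⇒∃¬ : ∀ {A : Set} {P : A → Set} → ¬ (∀ a → P a) → ∃ λ a → ¬ P a
  ¬∀⇒∃¬ h = stable λ k → h λ a → stable λ ¬p → k (a , ¬p)

  -- Infinite pigeonhole: if each of the finitely many `j` failed somewhere, antitonicity would make
  -- all of them fail at a common bound.
  persistent : ∀ {m} (P : Fin m → ℕ → Set) → (∀ j {a b} → a ≤ b → P j b → P j a) →
    (∀ b → ∃ λ j → P j b) → ∃ λ j → ∀ b → P j b
  persistent P anti ex = stable λ none →
    let b , fails = eventually-all (λ j b → ¬ P j b) (λ j a≤b ¬p p → ¬p (anti j a≤b p))
                      (λ j → ¬∀⇒∃¬ (λ h → none (j , h)))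
        j , p = ex b
    in fails j p

  argmin : ∀ {A : Set} {P : A → Set} (f : A → ℕ) → ∃ P →
    ∃ λ a → P a × (∀ b → P b → f a ≤ f b)
  argmin {A} {P} f (a , pa) = go (f a) a pa ℕₚ.≤-refl
    where
    go : ∀ d a → P a → f a ≤ d → ∃ λ a → P a × (∀ b → P b → f a ≤ f b)
    go d a pa fa≤d with em {P = ∃ λ b → P b × f b < f a}
    ... | no least = a , pa , λ b pb → ℕₚ.≮⇒≥ λ less → least (b , pb , less)
    go zero    a pa fa≤d | yes (b , pb , less) = ⊥-elim (ℕₚ.n≮0 (ℕₚ.<-≤-trans less fa≤d))
    go (suc d) a pa fa≤d | yes (b , pb , less) =
      go d b pb (ℕₚ.≤-pred (ℕₚ.<-≤-trans less fa≤d))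

  argmax : ∀ {A : Set} {P : A → Set} (f : A → ℕ) (bound : ℕ) → (∀ a → f a ≤ bound) → ∃ P →
    ∃ λ a → P a × (∀ b → P b → f b ≤ f a)
  argmax f bound f≤ ex with argmin (λ a → bound ∸ f a) ex
  ... | a , pa , least = a , pa , λ b pb → ℕₚ.≮⇒≥ λ less →
    ℕₚ.<⇒≱ (ℕₚ.∸-monoʳ-< less (f≤ b)) (least b pb)

  -- Since `step` never forces an increase, a smallest position that is ever reached can be kept
  -- forever. The induction on `d` restarts whenever a smaller one shows up.
  settles : ∀ {m} (A : ℕ → Fin m → Set) {t} →
    (∀ i j → t ≤ i → A i j → ∃ λ j′ → toℕ j′ ≤ toℕ j × A (suc i) j′) →
    ∃ (A t) → ∃ λ N → t ≤ N × ∃ λ j → ∀ i → N ≤ i → A i j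
  settles {m} A step (j , a) = go (toℕ j) _ j step a ℕₚ.≤-refl
    where
    go : ∀ d t j → (∀ i j → t ≤ i → A i j → ∃ λ j′ → toℕ j′ ≤ toℕ j × A (suc i) j′) →
      A t j → toℕ j ≤ d → ∃ λ N → t ≤ N × ∃ λ j → ∀ i → N ≤ i → A i j
    go d t j step a j≤d with em {P = ∃ λ i → t ≤ i × ∃ λ j′ → toℕ j′ < toℕ j × A i j′}
    ... | no least = t , ℕₚ.≤-refl , j , climb a λ i t≤i ai → stay i t≤i (step i j t≤i ai)
      where
      stay : ∀ i → t ≤ i → (∃ λ j′ → toℕ j′ ≤ toℕ j × A (suc i) j′) → A (suc i) j
      stay i t≤i (j′ , j′≤j , a′) with ℕₚ.m≤n⇒m<n∨m≡n j′≤j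
      ... | inj₁ less = ⊥-elim (least (suc i , ℕₚ.m≤n⇒m≤1+n t≤i , j′ , less , a′))
      ... | inj₂ j′≡j = subst (A (suc i)) (Finₚ.toℕ-injective j′≡j) a′
    go zero t j step a j≤d | yes (i , t≤i , j′ , less , a′) =
      ⊥-elim (ℕₚ.n≮0 (ℕₚ.<-≤-trans less j≤d))
    go (suc d) t j step a j≤d | yes (i , t≤i , j′ , less , a′)
      with go d i j′ (λ k l i≤k → step k l (ℕₚ.≤-trans t≤i i≤k)) a′
             (ℕₚ.≤-pred (ℕₚ.<-≤-trans less j≤d))
    ... | N , i≤N , rest = N , ℕₚ.≤-trans t≤i i≤N , rest

  -- König's lemma for layers of at most `n` nodes, stated with parents. Walking back from a deep
  -- layer gives long paths from layer 0; `persistent` selects a root, and then repeatedly a child,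
  -- with paths of every length below it.
  module König {n} (V : ℕ → Fin n → Set) (R : ℕ → Fin n → Fin n → Set)
    (inhabited : ∀ i → ∃ (V i))
    (parent : ∀ i q → V (suc i) q → ∃ λ p → V i p × R i p q) where

    Deep : ℕ → ℕ → Fin n → Set
    Deep zero    i p = V i p
    Deep (suc k) i p = V i p × ∃ λ q → R i p q × Deep k (suc i) q

    Deep⇒V : ∀ k {i p} → Deep k i p → V i p
    Deep⇒V zero v = v
    Deep⇒V (suc k) (v , _) = v

    Deep-anti : ∀ {k l i p} → k ≤ l → Deep l i p → Deep k i p
    Deep-anti {l = l} z≤n d = Deep⇒V l d
    Deep-anti (s≤s k≤l) (v , q , r , d) = v , q , r , Deep-anti k≤l d

    -- Each step to a parent goes up one layer and lengthens the path by one.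
    rooted : ∀ i k → ∃ (Deep k i) → ∃ (Deep (i + k) 0)
    rooted zero k d = d
    rooted (suc i) k (q , d) with parent i q (Deep⇒V k d)
    ... | p , v , r = subst (λ l → ∃ (Deep l 0)) (ℕₚ.+-suc i k)
                        (rooted i (suc k) (p , v , q , r , d))

    Immortal : ℕ → Fin n → Set
    Immortal i p = ∀ k → Deep k i p

    root : ∃ (Immortal 0)
    root = persistent (λ p k → Deep k 0 p) (λ p → Deep-anti)
      λ k → subst (λ l → ∃ (Deep l 0)) (ℕₚ.+-identityʳ k) (rooted k 0 (inhabited k))

    child : ∀ i p → Immortal i p → ∃ λ q → R i p q × Immortal (suc i) q
    child i p im with persistent (λ q k → R i p q × Deep k (suc i) q)
                        (λ q k≤l (r , d) → r , Deep-anti k≤l d) (λ k → proj₂ (im (suc k)))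
    ... | q , h = q , proj₁ (h 0) , λ k → proj₂ (h k)

    abstract
      node : ∀ i → ∃ (Immortal i)
      node zero    = root
      node (suc i) = let p , im = node i ; q , _ , im′ = child i p im in q , im′

      path : ℕ → Fin n
      path i = proj₁ (node i)

      path-V : ∀ i → V i (path i)
      path-V i = proj₂ (node i) 0

      path-R : ∀ i → R i (path i) (path (suc i))
      path-R i = let p , im = node i in proj₁ (proj₂ (child i p im))

  -- Comprehension for arbitrary predicates: set operations may quantify freely, while their results
  -- remain finite data that a state can store.
  ⟨_⟩ : ∀ {n} → (Fin n → Set) → Subset n
  ⟨ P ⟩ = tabulate λ q → ⌊ em {P = P q} ⌋

  ∈⟨⟩⁺ : ∀ {n} {P : Fin n → Set} {q} → P q → q ∈ₛ ⟨ P ⟩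
  ∈⟨⟩⁺ {P = P} {q} p = Vecₚ.lookup⇒[]= q ⟨ P ⟩
    (≡.trans (Vecₚ.lookup∘tabulate _ q) (≡.trans (isYes≗does em) (dec-true em p)))

  ∈⟨⟩⁻ : ∀ {n} {P : Fin n → Set} {q} → q ∈ₛ ⟨ P ⟩ → P q
  ∈⟨⟩⁻ {P = P} {q} q∈ with em {P = P q}
    | ≡.trans (sym (Vecₚ.lookup∘tabulate (λ q → ⌊ em {P = P q} ⌋) q)) (Vecₚ.[]=⇒lookup q∈)
  ... | yes p | _ = p
  ... | no _  | ()

  ⊆∧⊉⇒⊂ : ∀ {n} {P Q : Subset n} → P ⊆ Q → ¬ (Q ⊆ P) → P ⊂ Q
  ⊆∧⊉⇒⊂ P⊆Q Q⊈P = P⊆Q , stable λ none → Q⊈P λ {q} q∈Q →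
    stable λ q∉P → none (q , q∈Q , q∉P)

  ⊆∧card≥⇒⊇ : ∀ {n} {P Q : Subset n} → P ⊆ Q → card Q ≤ card P → Q ⊆ P
  ⊆∧card≥⇒⊇ P⊆Q Q≤P = stable λ Q⊈P →
    ℕₚ.<⇒≱ (p⊂q⇒∣p∣<∣q∣ (⊆∧⊉⇒⊂ P⊆Q Q⊈P)) Q≤P

-- Chains of subsets in order of age

∈-toList⁻ : ∀ {A : Set} {m} (V : Vec A m) {y} → y ∈ toList V → ∃ λ j → y ≡ lookup V j
∈-toList⁻ V y∈ = let y∈V = ∈-toList⇒∈ y∈ in VecAny.index y∈V , VecAnyₚ.lookup-index y∈V

-- Positions are natural numbers so that they can be compared across lists of different lengths.
data At {A : Set} : List A → ℕ → A → Set where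
  here  : ∀ {y xs} → At (y ∷ xs) 0 y
  there : ∀ {w xs j y} → At xs j y → At (w ∷ xs) (suc j) y

At-< : ∀ {A : Set} {xs : List A} {j y} → At xs j y → j < length xs
At-< here      = s≤s z≤n
At-< (there a) = s≤s (At-< a)

At-++ˡ : ∀ {A : Set} {xs ys : List A} {j y} → At xs j y → At (xs ++ ys) j y
At-++ˡ here      = here
At-++ˡ (there a) = there (At-++ˡ a)

At-++ʳ : ∀ {A : Set} (xs : List A) {ys j y} → At ys j y → At (xs ++ ys) (length xs + j) y
At-++ʳ []       a = a
At-++ʳ (w ∷ xs) a = there (At-++ʳ xs a)

At-toList : ∀ {A : Set} {m} (V : Vec A m) j → At (toList V) (toℕ j) (lookup V j)
At-toList (w ∷ V) zero    = here
At-toList (w ∷ V) (suc j) = there (At-toList V j)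

At-filter : ∀ {A : Set} {P : Pred A 0ℓ} (P? : Decidable P) {xs j y} → At xs j y → P y →
  ∃ λ j′ → j′ ≤ j × At (filter P? xs) j′ y
At-filter P? {y ∷ xs} here py with P? y
... | yes _ = 0 , z≤n , here
... | no ¬p = ⊥-elim (¬p py)
At-filter P? {w ∷ xs} (there a) py with P? w | At-filter P? a py
... | yes _ | j , j≤ , a′ = suc j , s≤s j≤ , there a′
... | no _  | j , j≤ , a′ = j , ℕₚ.m≤n⇒m≤1+n j≤ , a′

-- The first occurrence survives and gaps are closed, so a boundary can only move to an older
-- position.
At-deduplicate : ∀ {A : Set} (_≟_ : DecidableEquality A) {xs j y} → At xs j y →
  ∃ λ j′ → j′ ≤ j × At (deduplicate _≟_ xs) j′ y
At-deduplicate _≟_ here = 0 , z≤n , here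
At-deduplicate _≟_ {w ∷ xs} {y = y} (there a) with w ≟ y
... | yes refl = 0 , z≤n , here
... | no x≢y with At-deduplicate _≟_ a
...   | j , j≤ , a′ with At-filter (¬? ∘ (w ≟_)) a′ x≢y
...     | i , i≤j , a″ = suc i , s≤s (ℕₚ.≤-trans i≤j j≤) , there a″

unique⇒lookup-injective : ∀ {A : Set} {xs : List A} → Unique xs →
  ∀ i j → List.lookup xs i ≡ List.lookup xs j → i ≡ j
unique⇒lookup-injective (_ ∷ _) zero    zero    p≡ = refl
unique⇒lookup-injective {xs = w ∷ xs} (x∉ ∷ _) zero (suc j) p≡ =
  ⊥-elim (All.lookup x∉ (∈-lookup {xs = xs} j) p≡)
unique⇒lookup-injective {xs = w ∷ xs} (x∉ ∷ _) (suc i) zero p≡ =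
  ⊥-elim (All.lookup x∉ (∈-lookup {xs = xs} i) (sym p≡))
unique⇒lookup-injective (_ ∷ u) (suc i) (suc j) p≡ = cong suc (unique⇒lookup-injective u i j p≡)

pad : ∀ {A : Set} m → A → List A → Vec A m
pad zero    a _        = []
pad (suc m) a []       = a ∷ pad m a []
pad (suc m) a (w ∷ xs) = w ∷ pad m a xs

lookup-pad : ∀ {A : Set} {m} {a : A} {xs j y} → At xs j y → j < m →
  ∃ λ k → toℕ k ≡ j × lookup (pad m a xs) k ≡ y
lookup-pad here      (s≤s _)   = zero , refl , refl
lookup-pad (there p) (s≤s j<m) =
  let k , k≡j , p≡ = lookup-pad p j<m in suc k , cong suc k≡j , p≡

pad-∈ : ∀ {A : Set} {m} {a : A} xs k → lookup (pad m a xs) k ≡ a ⊎ lookup (pad m a xs) k ∈ xs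
pad-∈ {m = suc m} []       zero    = inj₁ refl
pad-∈ {m = suc m} []       (suc k) = pad-∈ [] k
pad-∈ {m = suc m} (w ∷ xs) zero    = inj₂ (here refl)
pad-∈ {m = suc m} (w ∷ xs) (suc k) with pad-∈ xs k
... | inj₁ p≡ = inj₁ p≡
... | inj₂ k∈ = inj₂ (there k∈)

Comparable : ∀ {n} → Subset n → Subset n → Set
Comparable P Q = P ⊆ Q ⊎ Q ⊆ P

Edges : ℕ → Set
Edges n = Vec (Subset n) n

Family : ℕ → Set
Family n = Vec (Subset n) (suc n)

infix 4 _∈ᶠ_
_∈ᶠ_ : ∀ {n} → Subset n → Family n → Set
Y ∈ᶠ V = ∃ λ j → lookup V j ≡ Y

_≟ₛ_ : ∀ {n} → DecidableEquality (Subset n)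
_≟ₛ_ = Vecₚ.≡-dec Boolₚ._≟_

-- Earlier positions hold older sets; the padding ∅ repeats position 0.
collect : ∀ {n} → List (Subset n) → Family n
collect Ys = pad _ ∅ (deduplicate _≟ₛ_ Ys)

module Families (em : ExcludedMiddle 0ℓ) {n : ℕ} where
  open Classical em

  Chain : List (Subset n) → Set
  Chain Ys = ∀ {P Q} → P ∈ Ys → Q ∈ Ys → Comparable P Q

  card-injective : ∀ {P Q : Subset n} → Comparable P Q → card P ≡ card Q → P ≡ Q
  card-injective (inj₁ P⊆Q) p≡ =
    ⊆-antisym P⊆Q (⊆∧card≥⇒⊇ P⊆Q (ℕₚ.≤-reflexive (sym p≡)))
  card-injective (inj₂ Q⊆P) p≡ =
    ⊆-antisym (⊆∧card≥⇒⊇ Q⊆P (ℕₚ.≤-reflexive p≡)) Q⊆P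

  -- Distinct members of a chain have distinct cardinalities, which range over 0, ..., `n`.
  chain-length : ∀ {Ys} → Chain Ys → Unique Ys → length Ys ≤ suc n
  chain-length {Ys} chain unique = Finₚ.injective⇒≤ {f = rank} λ {i} {j} p≡ →
    unique⇒lookup-injective unique i j
      (card-injective (chain (∈-lookup i) (∈-lookup j)) (rank-card i j p≡))
    where
    rank : Fin (length Ys) → Fin (suc n)
    rank i = fromℕ< (s≤s (∣p∣≤n (List.lookup Ys i)))
    rank-card : ∀ i j → rank i ≡ rank j → card (List.lookup Ys i) ≡ card (List.lookup Ys j)
    rank-card i j p≡ = ≡.trans (sym (Finₚ.toℕ-fromℕ< _)) (≡.trans (cong toℕ p≡) (Finₚ.toℕ-fromℕ< _))

  -- By `chain-length` the deduplicated chain fits into `suc n` positions, so `pad` cuts nothing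
  -- off.
  collect-At : ∀ {Ys j Y} → Chain Ys → At Ys j Y →
    ∃ λ k → toℕ k ≤ j × lookup (collect Ys) k ≡ Y
  collect-At {Ys} chain a =
    let i , i≤j , a′ = At-deduplicate _≟ₛ_ a
        k , k≡i , p≡ = lookup-pad a′ (ℕₚ.<-≤-trans (At-< a′) (chain-length
          (λ P∈ Q∈ → chain (∈-deduplicate⁻ _≟ₛ_ Ys P∈) (∈-deduplicate⁻ _≟ₛ_ Ys Q∈))
          (Uniqueₚ.deduplicate-! _≟ₛ_ Ys)))
    in k , ℕₚ.≤-trans (ℕₚ.≤-reflexive k≡i) i≤j , p≡

  collect-∈ : ∀ (Ys : List (Subset n)) k → lookup (collect Ys) k ≡ ∅ ⊎ lookup (collect Ys) k ∈ Ys
  collect-∈ Ys k with pad-∈ {a = ∅} (deduplicate _≟ₛ_ Ys) k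
  ... | inj₁ p≡ = inj₁ p≡
  ... | inj₂ k∈ = inj₂ (∈-deduplicate⁻ _≟ₛ_ Ys k∈)

  collect-zero : ∀ {Ys Y} → Chain Ys → At Ys 0 Y → lookup (collect Ys) zero ≡ Y
  collect-zero chain a with collect-At chain a
  ... | zero , _ , p≡ = p≡

  -- Position 0 is reserved for ∅, which leaves `n` positions to become Rabin pairs.
  record Good (V : Family n) : Set where
    field
      bottom : lookup V zero ≡ ∅
      chain  : ∀ {P Q} → P ∈ᶠ V → Q ∈ᶠ V → Comparable P Q

    ∅∈ᶠ : ∅ ∈ᶠ V
    ∅∈ᶠ = zero , bottom

    ⊂∨⊇ : ∀ {P Q} → P ∈ᶠ V → Q ∈ᶠ V → P ⊂ Q ⊎ Q ⊆ P
    ⊂∨⊇ {P} {Q} P∈ Q∈ with em {P = Q ⊆ P} | chain P∈ Q∈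
    ... | yes Q⊆P | _        = inj₂ Q⊆P
    ... | no  Q⊈P | inj₁ P⊆Q = inj₁ (⊆∧⊉⇒⊂ P⊆Q Q⊈P)
    ... | no  Q⊈P | inj₂ Q⊆P = inj₂ Q⊆P

  abstract
    post : Edges n → Subset n → Subset n
    post E P = ⟨ (λ q → ∃ λ p → p ∈ₛ P × q ∈ₛ lookup E p) ⟩

    -- In a chain this union is the member just before `P`, or ∅ if there is none. The slice ending
    -- at `P` is what `P` has beyond it.
    beneath : Family n → Subset n → Subset n
    beneath V P = ⟨ (λ q → ∃ λ Y → Y ∈ᶠ V × Y ⊂ P × q ∈ₛ Y) ⟩

    post⁺ : ∀ {E P p q} → p ∈ₛ P → q ∈ₛ lookup E p → q ∈ₛ post E P
    post⁺ p∈ e = ∈⟨⟩⁺ (_ , p∈ , e)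

    post⁻ : ∀ {E P q} → q ∈ₛ post E P → ∃ λ p → p ∈ₛ P × q ∈ₛ lookup E p
    post⁻ = ∈⟨⟩⁻

    beneath⁺ : ∀ {V P Y q} → Y ∈ᶠ V → Y ⊂ P → q ∈ₛ Y → q ∈ₛ beneath V P
    beneath⁺ Y∈ Y⊂P q∈Y = ∈⟨⟩⁺ (_ , Y∈ , Y⊂P , q∈Y)

    beneath⁻ : ∀ {V P q} → q ∈ₛ beneath V P → ∃ λ Y → Y ∈ᶠ V × Y ⊂ P × q ∈ₛ Y
    beneath⁻ = ∈⟨⟩⁻

  post-mono : ∀ {E P Q} → P ⊆ Q → post E P ⊆ post E Q
  post-mono P⊆Q q∈ = let p , p∈ , e = post⁻ q∈ in post⁺ (P⊆Q p∈) e

  post-∅ : ∀ E → post E ∅ ≡ ∅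
  post-∅ E = ⊆-antisym (λ q∈ → ⊥-elim (∉⊥ (proj₁ (proj₂ (post⁻ q∈))))) ⊥⊆

  beneath-mono : ∀ {V P Q} → P ⊆ Q → beneath V P ⊆ beneath V Q
  beneath-mono P⊆Q q∈ =
    let _ , Y∈ , Y⊂P , q∈Y = beneath⁻ q∈ in beneath⁺ Y∈ (⊂-⊆-trans Y⊂P P⊆Q) q∈Y

  beneath-⊆ : ∀ {V P} → beneath V P ⊆ P
  beneath-⊆ q∈ = let _ , _ , Y⊂P , q∈Y = beneath⁻ q∈ in proj₁ Y⊂P q∈Y

  -- One step on a family of boundaries

  module Step (F : Subset n) where

    -- The boundary between the F-successors and the other successors of the last slice of P.
    abstract
      split : Edges n → Family n → Subset n → Subset n
      split E V P = ⟨ (λ q → q ∈ₛ post E (beneath V P) ⊎ (q ∈ₛ post E P × q ∈ₛ F)) ⟩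

      split⁺ : ∀ {E V P q} → q ∈ₛ post E (beneath V P) ⊎ (q ∈ₛ post E P × q ∈ₛ F) →
        q ∈ₛ split E V P
      split⁺ = ∈⟨⟩⁺

      split⁻ : ∀ {E V P q} → q ∈ₛ split E V P →
        q ∈ₛ post E (beneath V P) ⊎ (q ∈ₛ post E P × q ∈ₛ F)
      split⁻ = ∈⟨⟩⁻

    -- Images precede splits: an image keeps the position of its source or gets an older one, and a
    -- split equal to an image is merged into it.
    candidates : Edges n → Family n → List (Subset n)
    candidates E V = toList (map (post E) V) ++ toList (map (split E V) V)

    next : Edges n → Family n → Family n
    next E V = collect (candidates E V)

    -- Position k + 1 is green if the slice ending at it has no successors outside F.
    greens : Edges n → Family n → Subset n
    greens E V = ⟨ (λ k → ∀ q → q ∈ₛ post E (lookup V (suc k)) → q ∉ₛ F →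
                     q ∈ₛ post E (beneath V (lookup V (suc k)))) ⟩

    -- Padded positions hold ∅, which is its own image and vacuously green; the nonemptiness
    -- condition makes them bad.
    bads : Edges n → Family n → Subset n
    bads E V = ⟨ (λ k → ¬ (lookup (next E V) (suc k) ≡ post E (lookup V (suc k))
                           × Nonempty (post E (lookup V (suc k))))) ⟩

    split-⊆ : ∀ {E V P} → split E V P ⊆ post E P
    split-⊆ q∈ with split⁻ q∈
    ... | inj₁ q∈p       = post-mono beneath-⊆ q∈p
    ... | inj₂ (q∈p , _) = q∈p

    post-beneath⊆split : ∀ {E V P} → post E (beneath V P) ⊆ split E V P
    post-beneath⊆split q∈ = split⁺ (inj₁ q∈)

    data Candidate (E : Edges n) (V : Family n) : Subset n → Set where
      posted : ∀ {P} → P ∈ᶠ V → Candidate E V (post E P)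
      splits : ∀ {P} → P ∈ᶠ V → Candidate E V (split E V P)

    candidates⁻ : ∀ E V {Y} → Y ∈ candidates E V → Candidate E V Y
    candidates⁻ E V Y∈ with ∈-++⁻ (toList (map (post E) V)) Y∈
    ... | inj₁ Y∈₁ with ∈-toList⁻ _ Y∈₁
    ...   | j , refl = subst (Candidate E V) (sym (Vecₚ.lookup-map j _ V)) (posted (j , refl))
    candidates⁻ E V Y∈ | inj₂ Y∈₂ with ∈-toList⁻ _ Y∈₂
    ...   | j , refl = subst (Candidate E V) (sym (Vecₚ.lookup-map j _ V)) (splits (j , refl))

    module _ (E : Edges n) {V : Family n} (good : Good V) where
      open Good good

      -- `P` is part of `beneath V Q`. Hence splits interleave with images, which is why the
      -- candidates form a chain again.
      ⊂⇒post⊆split : ∀ {P Q} → P ∈ᶠ V → P ⊂ Q → post E P ⊆ split E V Q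
      ⊂⇒post⊆split P∈ P⊂Q q∈ = post-beneath⊆split (post-mono (beneath⁺ P∈ P⊂Q) q∈)

      split-mono : ∀ {P Q} → P ⊆ Q → split E V P ⊆ split E V Q
      split-mono P⊆Q q∈ with split⁻ q∈
      ... | inj₁ q∈b         = split⁺ (inj₁ (post-mono (beneath-mono P⊆Q) q∈b))
      ... | inj₂ (q∈p , q∈F) = split⁺ (inj₂ (post-mono P⊆Q q∈p , q∈F))

      comparable : ∀ {Y Z} → Candidate E V Y → Candidate E V Z → Comparable Y Z
      comparable (posted P∈) (posted Q∈) with chain P∈ Q∈
      ... | inj₁ P⊆Q = inj₁ (post-mono P⊆Q)
      ... | inj₂ Q⊆P = inj₂ (post-mono Q⊆P)
      comparable (splits P∈) (splits Q∈) with chain P∈ Q∈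
      ... | inj₁ P⊆Q = inj₁ (split-mono P⊆Q)
      ... | inj₂ Q⊆P = inj₂ (split-mono Q⊆P)
      comparable (posted P∈) (splits Q∈) with ⊂∨⊇ P∈ Q∈
      ... | inj₁ P⊂Q = inj₁ (⊂⇒post⊆split P∈ P⊂Q)
      ... | inj₂ Q⊆P = inj₂ (⊆-trans split-⊆ (post-mono Q⊆P))
      comparable (splits P∈) (posted Q∈) with ⊂∨⊇ Q∈ P∈
      ... | inj₁ Q⊂P = inj₂ (⊂⇒post⊆split Q∈ Q⊂P)
      ... | inj₂ P⊆Q = inj₁ (⊆-trans split-⊆ (post-mono P⊆Q))

      candidates-chain : Chain (candidates E V)
      candidates-chain Y∈ Z∈ = comparable (candidates⁻ E V Y∈) (candidates⁻ E V Z∈)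

      next-post : ∀ j → ∃ λ k → toℕ k ≤ toℕ j × lookup (next E V) k ≡ post E (lookup V j)
      next-post j = collect-At candidates-chain (At-++ˡ (subst (At _ (toℕ j))
        (Vecₚ.lookup-map j (post E) V) (At-toList (map (post E) V) j)))

      next-split : ∀ {P} → P ∈ᶠ V → split E V P ∈ᶠ next E V
      next-split (j , refl) = let k , _ , p≡ = at in k , p≡
        where
        at = collect-At candidates-chain (At-++ʳ (toList (map (post E) V)) (subst (At _ (toℕ j))
               (Vecₚ.lookup-map j (split E V) V) (At-toList (map (split E V) V) j)))

      next-candidate : ∀ {Y} → Y ∈ᶠ next E V → Candidate E V Y
      next-candidate (k , refl) with collect-∈ (candidates E V) k
      -- The padding ∅ counts as the image of the bottom ∅.
      ... | inj₁ p≡ = subst (Candidate E V) (≡.trans (post-∅ E) (sym p≡)) (posted ∅∈ᶠ)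
      ... | inj₂ k∈ = candidates⁻ E V k∈

      next-good : Good (next E V)
      next-good = record
        { bottom = ≡.trans (bottom′ (next-post zero)) (≡.trans (cong (post E) bottom) (post-∅ E))
        ; chain  = λ P∈ Q∈ → comparable (next-candidate P∈) (next-candidate Q∈) }
        where
        bottom′ : (∃ λ k → toℕ k ≤ 0 × lookup (next E V) k ≡ post E (lookup V zero)) →
          lookup (next E V) zero ≡ post E (lookup V zero)
        bottom′ (zero , _ , p≡) = p≡

      -- A candidate strictly inside `post E W` must stem from some `P` strictly below `W`, or be a
      -- split of some `P` inside `W`. So what lies beneath the image of `W` comes from beneath `W`
      -- or has just entered `F`.
      beneath-next : ∀ {W} → W ∈ᶠ V → beneath (next E V) (post E W) ⊆ split E V W
      beneath-next {W} W∈ q∈ with beneath⁻ q∈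
      ... | Y , Y∈ , Y⊂ , q∈Y with next-candidate Y∈
      ...   | posted P∈ with ⊂∨⊇ P∈ W∈
      ...     | inj₁ P⊂W = ⊂⇒post⊆split P∈ P⊂W q∈Y
      ...     | inj₂ W⊆P = let _ , r , r∈ , r∉ = Y⊂ in ⊥-elim (r∉ (post-mono W⊆P r∈))
      beneath-next {W} W∈ q∈ | Y , Y∈ , Y⊂ , q∈Y | splits P∈ with ⊂∨⊇ W∈ P∈
      ...     | inj₁ W⊂P = let _ , r , r∈ , r∉ = Y⊂ in ⊥-elim (r∉ (⊂⇒post⊆split W∈ W⊂P r∈))
      ...     | inj₂ P⊆W = split-mono P⊆W q∈Y

-- Runs and families

module Runs (em : ExcludedMiddle 0ℓ) {n : ℕ} (I F : Subset n) (E : ℕ → Edges n) where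
  open Classical em
  open Families em {n}
  open Step F
  open Good

  start : Family n
  start = collect (∅ ∷ I ∷ [])

  fam : ℕ → Family n
  fam zero    = start
  fam (suc i) = next (E i) (fam i)

  BüchiRun : Set
  BüchiRun = ∃ λ (ρ : ℕ → Fin n) → ρ 0 ∈ₛ I × (∀ i → ρ (suc i) ∈ₛ lookup (E i) (ρ i))
    × (∀ N → ∃ λ i → N ≤ i × ρ i ∈ₛ F)

  RabinRun : Set
  RabinRun = ∃ λ k → (∀ N → ∃ λ i → N ≤ i × k ∈ₛ greens (E i) (fam i))
    × (∃ λ N → ∀ i → N ≤ i → k ∉ₛ bads (E i) (fam i))

  start-chain : Chain (∅ ∷ I ∷ [])
  start-chain (here refl)         _                   = inj₁ ⊥⊆
  start-chain (there (here refl)) (here refl)         = inj₂ ⊥⊆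
  start-chain (there (here refl)) (there (here refl)) = inj₁ ⊆-refl

  I∈start : I ∈ᶠ start
  I∈start = let k , _ , p≡ = collect-At start-chain (there here) in k , p≡

  start-⊆ : ∀ {Y} → Y ∈ᶠ start → Y ⊆ I
  start-⊆ (k , refl) with collect-∈ (∅ ∷ I ∷ []) k
  ... | inj₁ p≡                = ⊆-trans (⊆-reflexive p≡) ⊥⊆
  ... | inj₂ (here p≡)         = ⊆-trans (⊆-reflexive p≡) ⊥⊆
  ... | inj₂ (there (here p≡)) = ⊆-reflexive p≡

  fam-good : ∀ i → Good (fam i)
  fam-good zero = record
    { bottom = collect-zero start-chain here
    ; chain  = λ P∈ Q∈ → chain₀ P∈ Q∈ }
    where
    chain₀ : ∀ {P Q} → P ∈ᶠ start → Q ∈ᶠ start → Comparable P Q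
    chain₀ (j , refl) (k , refl) with collect-∈ (∅ ∷ I ∷ []) j | collect-∈ (∅ ∷ I ∷ []) k
    ... | inj₁ p≡ | _       = inj₁ (⊆-trans (⊆-reflexive p≡) ⊥⊆)
    ... | inj₂ _  | inj₁ p≡ = inj₂ (⊆-trans (⊆-reflexive p≡) ⊥⊆)
    ... | inj₂ j∈ | inj₂ k∈ = start-chain j∈ k∈
  fam-good (suc i) = next-good (E i) (fam-good i)

  Reach : ℕ → Subset n
  Reach zero    = I
  Reach (suc i) = post (E i) (Reach i)

  -- Needed to trace locations of the families back to `I` when König's lemma is applied.
  fam-⊆Reach : ∀ i {Y} → Y ∈ᶠ fam i → Y ⊆ Reach i
  fam-⊆Reach zero    Y∈ = start-⊆ Y∈
  fam-⊆Reach (suc i) Y∈ with next-candidate (E i) (fam-good i) Y∈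
  ... | posted P∈ = post-mono (fam-⊆Reach i P∈)
  ... | splits P∈ = ⊆-trans split-⊆ (post-mono (fam-⊆Reach i P∈))

  Trajectory : ℕ → (ℕ → Subset n) → Set
  Trajectory t Y = ∀ i → t ≤ i → Y (suc i) ≡ post (E i) (Y i)

  module _ {t : ℕ} where

    -- Images are always candidates, so a boundary may merge with others but never disappears from
    -- the families.
    trajectory-∈fam : ∀ {Y} → Trajectory t Y → Y t ∈ᶠ fam t → ∀ i → t ≤ i → Y i ∈ᶠ fam i
    trajectory-∈fam {Y} τ Yt∈ = climb Yt∈ λ where
      i t≤i (j , p≡) → let k , _ , eq′ = next-post (E i) (fam-good i) j
        in k , ≡.trans eq′ (≡.trans (cong (post (E i)) p≡) (sym (τ i t≤i)))

    trajectory-mono : ∀ {Y Z} → Trajectory t Y → Trajectory t Z → Y t ⊆ Z t →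
      ∀ i → t ≤ i → Y i ⊆ Z i
    trajectory-mono {Y} {Z} υ ζ Y⊆Z = climb {P = λ i → Y i ⊆ Z i} Y⊆Z λ i t≤i ih →
      ⊆-trans (⊆-reflexive (υ i t≤i)) (⊆-trans (post-mono ih) (⊆-reflexive (sym (ζ i t≤i))))

    delay : ∀ {s Y} → t ≤ s → Trajectory t Y → Trajectory s Y
    delay t≤s τ i s≤i = τ i (ℕₚ.≤-trans t≤s s≤i)

  -- The values before `t` are filler; keeping them at `Z` makes the value at `t` come out as `Z`.
  orbit : ℕ → Subset n → ℕ → Subset n
  orbit t Z zero = Z
  orbit t Z (suc i) with t ≤? i
  ... | yes _ = post (E i) (orbit t Z i)
  ... | no _  = Z

  orbit-start : ∀ t Z → orbit t Z t ≡ Z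
  orbit-start zero    Z = refl
  orbit-start (suc t) Z with suc t ≤? t
  ... | yes less = ⊥-elim (ℕₚ.1+n≰n less)
  ... | no _   = refl

  orbit-trajectory : ∀ t Z → Trajectory t (orbit t Z)
  orbit-trajectory t Z i t≤i with t ≤? i
  ... | yes _  = refl
  ... | no t≰i = ⊥-elim (t≰i t≤i)

  orbit-∈fam : ∀ {t Z} → Z ∈ᶠ fam t → ∀ i → t ≤ i → orbit t Z i ∈ᶠ fam i
  orbit-∈fam {t} {Z} (j , p≡) = trajectory-∈fam (orbit-trajectory t Z)
    (j , ≡.trans p≡ (sym (orbit-start t Z)))

  -- From an accepting run to a stable position that is green infinitely often

  module Completeness (ρ : ℕ → Fin n) (edge : ∀ i → ρ (suc i) ∈ₛ lookup (E i) (ρ i))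
    (often : ∀ N → ∃ λ i → N ≤ i × ρ i ∈ₛ F) where

    ρ∈ : ∀ {t Y} → Trajectory t Y → ρ t ∈ₛ Y t → ∀ i → t ≤ i → ρ i ∈ₛ Y i
    ρ∈ {t} {Y} τ = λ ρt∈ → climb ρt∈ λ i t≤i ρi∈ →
      subst (ρ (suc i) ∈ₛ_) (sym (τ i t≤i)) (post⁺ ρi∈ (edge i))

    -- If the stable position of X is green only finitely often, some split of X at a visit of ρ to F
    -- stays strictly below X forever, so d decreases.
    rabin : ∀ d t X → Trajectory t X → X t ∈ᶠ fam t → ρ t ∈ₛ X t →
      (∀ i → t ≤ i → card (X i) ≤ d) → RabinRun
    rabin d t X τ Xt∈ ρt∈ small with settles (λ i j → lookup (fam i) j ≡ X i) {t} older Xt∈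
      where
      older : ∀ i j → t ≤ i → lookup (fam i) j ≡ X i →
        ∃ λ k → toℕ k ≤ toℕ j × lookup (fam (suc i)) k ≡ X (suc i)
      older i j t≤i p≡ = let k , k≤j , eq′ = next-post (E i) (fam-good i) j in
        k , k≤j , ≡.trans eq′ (≡.trans (cong (post (E i)) p≡) (sym (τ i t≤i)))
    -- Position 0 holds ∅, whereas `X N` contains `ρ N`.
    ... | N , t≤N , zero , at = ⊥-elim (∉⊥ (subst (ρ N ∈ₛ_)
            (≡.trans (sym (at N ℕₚ.≤-refl)) (bottom (fam-good N))) (ρ∈ τ ρt∈ N t≤N)))
    ... | N , t≤N , suc k , at with em {P = ∀ M → ∃ λ i → M ≤ i × k ∈ₛ greens (E i) (fam i)}
    ...   | yes green = k , green , N , λ i N≤i k∈bads → ∈⟨⟩⁻ k∈bads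
              ( ≡.trans (at (suc i) (ℕₚ.m≤n⇒m≤1+n N≤i))
                  (≡.trans (τ i (ℕₚ.≤-trans t≤N N≤i)) (cong (post (E i)) (sym (at i N≤i))))
              , ρ (suc i) , post⁺ (subst (ρ i ∈ₛ_) (sym (at i N≤i))
                              (ρ∈ τ ρt∈ i (ℕₚ.≤-trans t≤N N≤i))) (edge i))
    ...   | no rare with ¬∀⇒∃¬ rare
    ...     | M , none = shrink d small
      where
      L : ℕ
      L = N ⊔ M
      F-visit : ∃ λ i → L ≤ i × ρ (suc i) ∈ₛ F
      -- Splitting tests successors for `F`, so the visit is wanted at a time `suc i`; the bound
      -- `suc L` excludes time 0.
      F-visit with often (suc L)
      ... | suc i , s≤s L≤i , ρi∈F = i , L≤i , ρi∈F
      s : ℕ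
      s = proj₁ F-visit
      L≤s : L ≤ s
      L≤s = proj₁ (proj₂ F-visit)
      C : ℕ → Subset n
      C i = split (E i) (fam i) (X i)
      Y : ℕ → Subset n
      Y = orbit (suc s) (C s)
      t≤ : ∀ {i} → s ≤ i → t ≤ i
      t≤ s≤i = ℕₚ.≤-trans t≤N (ℕₚ.≤-trans (ℕₚ.m≤m⊔n N M) (ℕₚ.≤-trans L≤s s≤i))
      X∈ : ∀ i → s ≤ i → X i ∈ᶠ fam i
      X∈ i s≤i = trajectory-∈fam τ Xt∈ i (t≤ s≤i)
      C∈ : ∀ i → s ≤ i → C i ∈ᶠ fam (suc i)
      C∈ i s≤i = next-split (E i) (fam-good i) (X∈ i s≤i)
      -- Position k is not green at i, so the sibling of the F-successors is nonempty.
      C⊂X : ∀ i → s ≤ i → C i ⊂ X (suc i)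
      C⊂X i s≤i rewrite τ i (t≤ s≤i) = ⊆∧⊉⇒⊂ split-⊆ λ X⊆C →
        none (i , ℕₚ.≤-trans (ℕₚ.m≤n⊔m N M) (ℕₚ.≤-trans L≤s s≤i) , ∈⟨⟩⁺ (green X⊆C))
        where
        N≤i : N ≤ i
        N≤i = ℕₚ.≤-trans (ℕₚ.m≤m⊔n N M) (ℕₚ.≤-trans L≤s s≤i)
        green : post (E i) (X i) ⊆ C i → ∀ q → q ∈ₛ post (E i) (lookup (fam i) (suc k)) →
          q ∉ₛ F → q ∈ₛ post (E i) (beneath (fam i) (lookup (fam i) (suc k)))
        green X⊆C rewrite at i N≤i = λ q q∈ q∉F → case-split q∉F (split⁻ (X⊆C q∈))
          where
          case-split : ∀ {q} → q ∉ₛ F →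
            q ∈ₛ post (E i) (beneath (fam i) (X i)) ⊎ (q ∈ₛ post (E i) (X i) × q ∈ₛ F) →
            q ∈ₛ post (E i) (beneath (fam i) (X i))
          case-split q∉F (inj₁ q∈b)       = q∈b
          case-split q∉F (inj₂ (_ , q∈F)) = ⊥-elim (q∉F q∈F)
      -- `C i` is a member of the next family strictly below `X (suc i)`, hence part of `beneath`;
      -- so its image lies in the next split `C (suc i)`.
      Y⊆C : ∀ i → s ≤ i → Y (suc i) ⊆ C i
      Y⊆C = climb {P = λ i → Y (suc i) ⊆ C i} (⊆-reflexive (orbit-start (suc s) (C s)))
        λ i s≤i ih → ⊆-trans (⊆-reflexive (orbit-trajectory (suc s) (C s) (suc i) (s≤s s≤i)))
          (⊆-trans (post-mono (⊆-trans ih (beneath⁺ (C∈ i s≤i) (C⊂X i s≤i)))) post-beneath⊆split)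
      smaller : ∀ i → suc s ≤ i → card (Y i) < card (X i)
      smaller (suc i) (s≤s s≤i) = p⊂q⇒∣p∣<∣q∣ (⊆-⊂-trans (Y⊆C i s≤i) (C⊂X i s≤i))
      t≤s+1 : ∀ {i} → suc s ≤ i → t ≤ i
      t≤s+1 less = t≤ (ℕₚ.<⇒≤ less)
      shrink : ∀ d → (∀ i → t ≤ i → card (X i) ≤ d) → RabinRun
      shrink zero small = ⊥-elim (ℕₚ.n≮0 (ℕₚ.<-≤-trans (smaller (suc s) ℕₚ.≤-refl)
        (small (suc s) (t≤s+1 ℕₚ.≤-refl))))
      shrink (suc d) small = rabin d (suc s) Y (orbit-trajectory (suc s) (C s))
        (subst (_∈ᶠ fam (suc s)) (sym (orbit-start (suc s) (C s))) (C∈ s ℕₚ.≤-refl))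
        (subst (ρ (suc s) ∈ₛ_) (sym (orbit-start (suc s) (C s)))
          (split⁺ (inj₂ (post⁺ (ρ∈ τ ρt∈ s (t≤ ℕₚ.≤-refl)) (edge s) , proj₂ (proj₂ F-visit)))))
        λ i s<i → ℕₚ.≤-pred (ℕₚ.<-≤-trans (smaller i s<i) (small i (t≤s+1 s<i)))

  complete : BüchiRun → RabinRun
  complete (ρ , ρ0∈I , edge , often) = Completeness.rabin ρ edge often n 0 (orbit 0 I)
    (orbit-trajectory 0 I) I∈start ρ0∈I (λ i _ → ∣p∣≤n (orbit 0 I i))

  -- From a stable position that is green infinitely often to an accepting run

  module Soundness (m : ℕ) (k : Fin n)
    (green : ∀ N → ∃ λ i → N ≤ i × k ∈ₛ greens (E i) (fam i))
    (stays : ∀ i → m ≤ i → k ∉ₛ bads (E i) (fam i)) where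

    X : ℕ → Subset n
    X i = lookup (fam i) (suc k)

    X∈ : ∀ i → X i ∈ᶠ fam i
    X∈ i = suc k , refl

    stay : ∀ i → m ≤ i → X (suc i) ≡ post (E i) (X i) × Nonempty (post (E i) (X i))
    stay i m≤i = stable λ ¬s → stays i m≤i (∈⟨⟩⁺ ¬s)

    X-trajectory : Trajectory m X
    X-trajectory i m≤i = proj₁ (stay i m≤i)

    -- X ∖ Z contains a single infinite branch of slices: every later member of the family that
    -- lies between Z and X eventually coincides with one of them.
    module Isolated (t : ℕ) (Z : ℕ → Subset n) (m≤t : m ≤ t) (ζ : Trajectory t Z)
      (Z∈ : Z t ∈ᶠ fam t) (X⊈Z : ∀ i → t ≤ i → ¬ (X i ⊆ Z i))
      (isolated : ∀ s → t ≤ s → ∀ Y → Trajectory s Y → Y s ∈ᶠ fam s → Z s ⊆ Y s →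
                (∀ i → s ≤ i → ¬ (X i ⊆ Y i)) → ∃ λ i → s ≤ i × Y i ⊆ Z i) where

      ξ : Trajectory t X
      ξ = delay m≤t X-trajectory

      Z∈fam : ∀ i → t ≤ i → Z i ∈ᶠ fam i
      Z∈fam = trajectory-∈fam ζ Z∈

      D : ℕ → Fin n → Set
      D i q = q ∈ₛ X i × q ∉ₛ Z i

      -- `Z` absorbs the successors of its elements, so a predecessor of a location outside `Z` is
      -- outside `Z` too.
      D-parent : ∀ i → t ≤ i → ∀ {p q} → q ∈ₛ lookup (E i) p → p ∈ₛ X i → D (suc i) q → D i p
      D-parent i t≤i e p∈X (_ , q∉Z) =
        p∈X , λ p∈Z → q∉Z (subst (_ ∈ₛ_) (sym (ζ i t≤i)) (post⁺ p∈Z e))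

      D-predecessor : ∀ i → t ≤ i → ∀ {q} → D (suc i) q → ∃ λ p → D i p × q ∈ₛ lookup (E i) p
      D-predecessor i t≤i {q} Dq =
        let p , p∈X , e = post⁻ (subst (q ∈ₛ_) (ξ i t≤i) (proj₁ Dq))
        in p , D-parent i t≤i e p∈X Dq , e

      -- Miyano–Hayashi breakpoints: B i collects the states of D i reached through F since
      -- the last time B filled all of D.
      B : ℕ → Fin n → Set
      B zero    q = ⊥
      B (suc i) q = D (suc i) q × (q ∈ₛ F ⊎
        (¬ (∀ p → D i p → B i p) × ∃ λ p → D i p × B i p × q ∈ₛ lookup (E i) p))

      Break : ℕ → Set
      Break i = ∀ p → D i p → B i p

      -- Without a break after N, B would contain whatever leaves the slice above V through F;
      -- once V has fallen to Z and W has reached X, the next green step completes a break.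
      module NoBreak (N : ℕ) (t≤N : t ≤ N) (unbroken : ∀ i → N ≤ i → ¬ Break i) where

        Catches : Subset n → Set
        Catches Y = ∃ λ i → N ≤ i × X i ⊆ orbit N Y i

        Z-slow : ¬ Catches (Z N)
        Z-slow (i , N≤i , X⊆) = X⊈Z i (ℕₚ.≤-trans t≤N N≤i) (⊆-trans X⊆
          (trajectory-mono (orbit-trajectory N (Z N)) (delay t≤N ζ)
            (⊆-reflexive (orbit-start N (Z N))) i N≤i))

        X-fast : Catches (X N)
        X-fast = N , ℕₚ.≤-refl , ⊆-reflexive (sym (orbit-start N (X N)))

        -- The surviving branch runs between V₀, the largest set never catching up with X, and
        -- W₀, the smallest one that does.
        abstract
          low : ∃ λ V → (V ∈ᶠ fam N × ¬ Catches V) ×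
            (∀ Y → Y ∈ᶠ fam N × ¬ Catches Y → card Y ≤ card V)
          low = argmax {P = λ Y → Y ∈ᶠ fam N × ¬ Catches Y} card n ∣p∣≤n
            (Z N , Z∈fam N t≤N , Z-slow)

          high : ∃ λ W → (W ∈ᶠ fam N × Catches W) ×
            (∀ Y → Y ∈ᶠ fam N × Catches Y → card W ≤ card Y)
          high = argmin {P = λ Y → Y ∈ᶠ fam N × Catches Y} card (X N , X∈ N , X-fast)

        V₀ W₀ : Subset n
        V₀ = proj₁ low
        W₀ = proj₁ high

        V W : ℕ → Subset n
        V = orbit N V₀
        W = orbit N W₀

        V₀∈ : V₀ ∈ᶠ fam N
        V₀∈ = proj₁ (proj₁ (proj₂ low))

        W₀∈ : W₀ ∈ᶠ fam N
        W₀∈ = proj₁ (proj₁ (proj₂ high))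

        V₀-greatest : ∀ {Y} → Y ∈ᶠ fam N → ¬ Catches Y → Y ⊆ V₀
        V₀-greatest Y∈ slow with chain (fam-good N) Y∈ V₀∈
        ... | inj₁ Y⊆V = Y⊆V
        ... | inj₂ V⊆Y = ⊆∧card≥⇒⊇ V⊆Y (proj₂ (proj₂ low) _ (Y∈ , slow))

        -- By minimality of `W₀` nothing strictly below it catches up, so no member of `fam N` lies
        -- strictly between `V₀` and `W₀`.
        beneath-W₀ : beneath (fam N) W₀ ⊆ V₀
        beneath-W₀ q∈ with beneath⁻ q∈
        ... | Y , Y∈ , Y⊂W , q∈Y = V₀-greatest Y∈
          (λ fast → ℕₚ.<⇒≱ (p⊂q⇒∣p∣<∣q∣ Y⊂W) (proj₂ (proj₂ high) _ (Y∈ , fast))) q∈Y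

        abstract
          -- `V` starts above `Z` and never covers `X`; isolation leaves it no choice but to
          -- collapse to `Z`.
          falls : ∃ λ i → N ≤ i × V i ⊆ Z i
          falls = isolated N t≤N V (orbit-trajectory N V₀) (orbit-∈fam V₀∈ N ℕₚ.≤-refl)
            (λ q∈Z → subst (_ ∈ₛ_) (sym (orbit-start N V₀)) (Z⊆V₀ q∈Z))
            λ i N≤i X⊆V → proj₂ (proj₁ (proj₂ low)) (i , N≤i , X⊆V)
            where
            Z⊆V₀ : Z N ⊆ V₀
            Z⊆V₀ = V₀-greatest (Z∈fam N t≤N) Z-slow

          catches : ∃ λ i → N ≤ i × X i ⊆ W i
          catches = proj₂ (proj₁ (proj₂ high))

        W₀⊆X : W₀ ⊆ X N
        W₀⊆X with chain (fam-good N) W₀∈ (X∈ N)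
        ... | inj₁ W⊆X = W⊆X
        ... | inj₂ X⊆W = ⊆∧card≥⇒⊇ X⊆W (proj₂ (proj₂ high) _ (X∈ N , X-fast))

        W⊆X : ∀ i → N ≤ i → W i ⊆ X i
        W⊆X = trajectory-mono (orbit-trajectory N W₀) (delay t≤N ξ)
          (⊆-trans (⊆-reflexive (orbit-start N W₀)) W₀⊆X)

        -- At `N` there is no such location. Later, by `beneath-next`, it has just entered `F` or
        -- has a predecessor of the same kind, from which it inherits membership in `B`, as no break
        -- resets `B`.
        visited : ∀ i → N ≤ i → ∀ q → q ∈ₛ beneath (fam i) (W i) → q ∉ₛ V i → D i q → B i q
        visited = climb base step
          where
          base : ∀ q → q ∈ₛ beneath (fam N) (W N) → q ∉ₛ V N → D N q → B N q
          base q rewrite orbit-start N W₀ | orbit-start N V₀ =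
            λ q∈ q∉V _ → ⊥-elim (q∉V (beneath-W₀ q∈))
          step : ∀ i → N ≤ i →
            (∀ q → q ∈ₛ beneath (fam i) (W i) → q ∉ₛ V i → D i q → B i q) →
            ∀ q → q ∈ₛ beneath (fam (suc i)) (W (suc i)) → q ∉ₛ V (suc i) →
            D (suc i) q → B (suc i) q
          step i N≤i ih q q∈ q∉V Dq
            with split⁻ (beneath-next (E i) (fam-good i) (orbit-∈fam W₀∈ i N≤i)
                   (subst (λ P → q ∈ₛ beneath (fam (suc i)) P) (orbit-trajectory N W₀ i N≤i) q∈))
          ... | inj₂ (_ , q∈F) = Dq , inj₁ q∈F
          ... | inj₁ q∈b =
            let p , p∈b , e = post⁻ q∈b
                Dp = D-parent i (ℕₚ.≤-trans t≤N N≤i) e (W⊆X i N≤i (beneath-⊆ p∈b)) Dq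
            in Dq , inj₂ (unbroken i N≤i , p , Dp , ih p p∈b
                 (λ p∈V → q∉V (subst (q ∈ₛ_) (sym (orbit-trajectory N V₀ i N≤i)) (post⁺ p∈V e)))
                 Dp , e)

        contradictory : ⊥
        contradictory with green (proj₁ falls ⊔ proj₁ catches)
        ... | i , L≤i , k∈green = unbroken (suc i) (ℕₚ.m≤n⇒m≤1+n N≤i) full
          where
          i≥f : proj₁ falls ≤ i
          i≥f = ℕₚ.≤-trans (ℕₚ.m≤m⊔n _ (proj₁ catches)) L≤i
          i≥c : proj₁ catches ≤ i
          i≥c = ℕₚ.≤-trans (ℕₚ.m≤n⊔m (proj₁ falls) _) L≤i
          N≤i : N ≤ i
          N≤i = ℕₚ.≤-trans (proj₁ (proj₂ falls)) i≥f
          t≤i : t ≤ i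
          t≤i = ℕₚ.≤-trans t≤N N≤i
          V⊆Z : V i ⊆ Z i
          V⊆Z = trajectory-mono (delay (proj₁ (proj₂ falls)) (orbit-trajectory N V₀))
            (delay (ℕₚ.≤-trans t≤N (proj₁ (proj₂ falls))) ζ) (proj₂ (proj₂ falls)) i i≥f
          X⊆W : X i ⊆ W i
          X⊆W = trajectory-mono (delay (ℕₚ.≤-trans t≤N (proj₁ (proj₂ catches))) ξ)
            (delay (proj₁ (proj₂ catches)) (orbit-trajectory N W₀)) (proj₂ (proj₂ catches)) i i≥c
          full : Break (suc i)
          full q Dq with em {P = q ∈ₛ F}
          ... | yes q∈F = Dq , inj₁ q∈F
          ... | no  q∉F =
            -- Greenness puts a predecessor beneath `X i`, hence beneath `W i`. It is outside `Z i`,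
            -- hence outside `V i`, so `visited` applies and `B` fills all of `D`.
            let p , p∈b , e = post⁻ (∈⟨⟩⁻ k∈green q (subst (q ∈ₛ_) (ξ i t≤i) (proj₁ Dq)) q∉F)
                Dp = D-parent i t≤i e (beneath-⊆ p∈b) Dq
            in Dq , inj₂ (unbroken i N≤i , p , Dp ,
                 visited i N≤i p (beneath-mono X⊆W p∈b) (λ p∈V → proj₂ Dp (V⊆Z p∈V)) Dp , e)

      abstract
        breaks : ∀ N → ∃ λ i → N ≤ i × t ≤ i × Break i
        breaks N = stable λ none → NoBreak.contradictory (N ⊔ t) (ℕₚ.m≤n⊔m N t)
          λ i le br → none (i , ℕₚ.≤-trans (ℕₚ.m≤m⊔n N t) le , ℕₚ.≤-trans (ℕₚ.m≤n⊔m N t) le , br)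

      Layer : ℕ → Fin n → Set
      Layer i q = q ∈ₛ Reach i × (t ≤ i → D i q)

      -- Apart from being edges, arcs record where `B` comes from: a location of `B` outside `F`
      -- inherits its membership from its parent, and no break occurs there.
      Arc : ℕ → Fin n → Fin n → Set
      Arc i p q = q ∈ₛ lookup (E i) p ×
        (t ≤ i → B (suc i) q → q ∉ₛ F → ¬ Break i × B i p)

      parent : ∀ i q → Layer (suc i) q → ∃ λ p → Layer i p × Arc i p q
      parent i q (q∈R , Dq) with t ≤? i
      ... | no t≰i = let p , p∈R , e = post⁻ q∈R in
        p , (p∈R , λ t≤i → ⊥-elim (t≰i t≤i)) , e , λ t≤i → ⊥-elim (t≰i t≤i)
      ... | yes t≤i with em {P = B (suc i) q × q ∉ₛ F}
      ...   | yes ((_ , inj₁ q∈F) , q∉F) = ⊥-elim (q∉F q∈F)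
      ...   | yes ((_ , inj₂ (¬br , p , Dp , Bp , e)) , q∉F) =
        p , (fam-⊆Reach i (X∈ i) (proj₁ Dp) , λ _ → Dp) , e , λ _ _ _ → ¬br , Bp
      ...   | no ¬B = let p , Dp , e = D-predecessor i t≤i (Dq (ℕₚ.m≤n⇒m≤1+n t≤i)) in
        p , (fam-⊆Reach i (X∈ i) (proj₁ Dp) , λ _ → Dp) , e , λ _ Bq q∉F → ⊥-elim (¬B (Bq , q∉F))

      inhabited : ∀ i → ∃ (Layer i)
      -- Layer `t + i` is inhabited because `X` is not covered by `Z` at that time; `t` steps to
      -- parents lead back to layer `i`.
      inhabited i = back t (let q , q∈X , q∉Z = escape in
        q , fam-⊆Reach (t + i) (X∈ (t + i)) q∈X , λ _ → q∈X , q∉Z)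
        where
        escape : ∃ (D (t + i))
        escape = stable λ none → X⊈Z (t + i) (ℕₚ.m≤m+n t i) λ {q} q∈X →
          stable λ q∉Z → none (q , q∈X , q∉Z)
        back : ∀ k → ∃ (Layer (k + i)) → ∃ (Layer i)
        back zero    l       = l
        back (suc k) (q , l) = let p , l′ , _ = parent (k + i) q l in back k (p , l′)

      open König Layer Arc inhabited parent

      büchi : BüchiRun
      büchi = path , proj₁ (path-V 0) , (λ i → proj₁ (path-R i)) , often
        where
        -- Take breaks `i` < `j`. At `j` the path is in `B`; if it avoided `F` back to `suc i`,
        -- membership would be inherited down to there, and the arc into `suc i` would exclude the
        -- break at `i`.
        often : ∀ N → ∃ λ i → N ≤ i × path i ∈ₛ F
        often N with breaks N
        ... | i , N≤i , t≤i , br with breaks (suc i)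
        ...   | j , i<j , t≤j , br′ = search (j ∸ suc i)
                (subst (λ l → B l (path l)) (sym (ℕₚ.m∸n+n≡m i<j))
                  (br′ (path j) (proj₂ (path-V j) t≤j)))
          where
          search : ∀ k → B (k + suc i) (path (k + suc i)) → ∃ λ i → N ≤ i × path i ∈ₛ F
          search k b with em {P = path (k + suc i) ∈ₛ F}
          ... | yes f∈F = k + suc i , ℕₚ.≤-trans N≤i (ℕₚ.≤-trans (ℕₚ.n≤1+n i) (ℕₚ.m≤n+m (suc i) k)) , f∈F
          search zero    b | no f∉F = ⊥-elim (proj₁ (proj₂ (path-R i) t≤i b f∉F) br)
          search (suc k) b | no f∉F = search k (proj₂ (proj₂ (path-R (k + suc i))
            (ℕₚ.≤-trans t≤i (ℕₚ.≤-trans (ℕₚ.n≤1+n i) (ℕₚ.m≤n+m (suc i) k))) b f∉F))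

    -- Z is raised until a single infinite branch is left between Z and X.
    descend : ∀ d t Z → m ≤ t → Trajectory t Z → Z t ∈ᶠ fam t → (∀ i → t ≤ i → ¬ (X i ⊆ Z i)) →
      (∀ i → t ≤ i → card (X i) ≤ d + card (Z i)) → BüchiRun
    descend d t Z m≤t ζ Z∈ X⊈Z small with em {P = ∃ λ s → t ≤ s × ∃ λ Y → Trajectory s Y ×
      Y s ∈ᶠ fam s × Z s ⊆ Y s × (∀ i → s ≤ i → ¬ (X i ⊆ Y i)) × (∀ i → s ≤ i → ¬ (Y i ⊆ Z i))}
    ... | no none = Isolated.büchi t Z m≤t ζ Z∈ X⊈Z λ s t≤s Y υ Y∈ Z⊆Y X⊈Y →
      stable {P = ∃ λ i → s ≤ i × Y i ⊆ Z i} λ never → none (s , t≤s , Y , υ , Y∈ , Z⊆Y , X⊈Y ,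
        λ i s≤i Y⊆Z → never (i , s≤i , Y⊆Z))
    descend zero t Z m≤t ζ Z∈ X⊈Z small | yes _ = ⊥-elim (X⊈Z t ℕₚ.≤-refl X⊆Z)
      where
      X⊆Z : X t ⊆ Z t
      X⊆Z with chain (fam-good t) Z∈ (X∈ t)
      ... | inj₁ Z⊆X = ⊆∧card≥⇒⊇ Z⊆X (small t ℕₚ.≤-refl)
      ... | inj₂ X⊆Z = X⊆Z
    descend (suc d) t Z m≤t ζ Z∈ X⊈Z small | yes (s , t≤s , Y , υ , Y∈ , Z⊆Y , X⊈Y , Y⊈Z) =
      descend d s Y (ℕₚ.≤-trans m≤t t≤s) υ Y∈ X⊈Y λ i s≤i →
        ℕₚ.≤-trans (small i (ℕₚ.≤-trans t≤s s≤i))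
          (ℕₚ.≤-trans (ℕₚ.≤-reflexive (sym (ℕₚ.+-suc d (card (Z i)))))
            (ℕₚ.+-monoʳ-≤ d (p⊂q⇒∣p∣<∣q∣
              (⊆∧⊉⇒⊂ (trajectory-mono (delay t≤s ζ) υ Z⊆Y i s≤i) (Y⊈Z i s≤i)))))

  sound : RabinRun → BüchiRun
  -- `stays` shows that images are nonempty, hence `X` from `suc m` on, so that the orbit of ∅
  -- cannot cover it.
  sound (k , green , m , stays) = descend n (suc m) (orbit (suc m) ∅) (ℕₚ.n≤1+n m)
    (orbit-trajectory (suc m) ∅) (orbit-∈fam (∅∈ᶠ (fam-good (suc m))) (suc m) ℕₚ.≤-refl)
    nonempty λ i _ → ℕₚ.≤-trans (∣p∣≤n (X i)) (ℕₚ.m≤m+n n _)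
    where
    open Soundness m k green stays
    empty : ∀ i → suc m ≤ i → orbit (suc m) ∅ i ⊆ ∅
    empty = climb {P = λ i → orbit (suc m) ∅ i ⊆ ∅} (⊆-reflexive (orbit-start (suc m) ∅))
      λ i m<i ih → ⊆-trans (⊆-reflexive (orbit-trajectory (suc m) ∅ i m<i))
        (⊆-trans (post-mono ih) (⊆-reflexive (post-∅ (E i))))
    nonempty : ∀ i → suc m ≤ i → ¬ (X i ⊆ orbit (suc m) ∅ i)
    nonempty (suc i) (s≤s m≤i) X⊆ with stay i m≤i
    ... | p≡ , q , q∈ = ∉⊥ (empty (suc i) (s≤s m≤i) (X⊆ (subst (q ∈ₛ_) (sym p≡) q∈)))

-- Types

length-cartesianProductWith : ∀ {A B C : Set} (f : A → B → C) xs ys →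
  length (cartesianProductWith f xs ys) ≡ length xs * length ys
length-cartesianProductWith f []       ys = refl
length-cartesianProductWith f (a ∷ xs) ys = ≡.trans (Listₚ.length-++ (List.map (f a) ys))
  (cong₂ _+_ (Listₚ.length-map (f a) ys) (length-cartesianProductWith f xs ys))

length-concatMap-≤ : ∀ {A B : Set} (f : A → List B) k → (∀ a → length (f a) ≤ k) →
  ∀ xs → length (concatMap f xs) ≤ length xs * k
length-concatMap-≤ f k f≤ []       = z≤n
length-concatMap-≤ f k f≤ (a ∷ xs) = ℕₚ.≤-trans (ℕₚ.≤-reflexive (Listₚ.length-++ (f a)))
  (ℕₚ.+-mono-≤ (f≤ a) (length-concatMap-≤ f k f≤ xs))

module _ {A : Set} {P : A → Set} where

  map-allFin⁺ : ∀ {m} (f : Fin m → A) → (∀ i → P (f i)) → All P (List.map f (allFin m))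
  map-allFin⁺ f p = Allₚ.map⁺ (All.tabulate λ {i} _ → p i)

  map-allFin⁻ : ∀ {m} (f : Fin m → A) → All P (List.map f (allFin m)) → ∀ i → P (f i)
  map-allFin⁻ f ps i = All.lookup (Allₚ.map⁻ ps) (∈-allFin i)

  concatMap-allFin⁺ : ∀ {m} (f : Fin m → List A) → (∀ i → All P (f i)) → All P (concatMap f (allFin m))
  concatMap-allFin⁺ {m} f p = Allₚ.concat⁺ {xss = List.map f (allFin m)}
    (Allₚ.map⁺ (All.tabulate λ {i} _ → p i))

  concatMap-allFin⁻ : ∀ {m} (f : Fin m → List A) → All P (concatMap f (allFin m)) → ∀ i → All P (f i)
  concatMap-allFin⁻ {m} f ps i =
    All.lookup (Allₚ.map⁻ (Allₚ.concat⁻ {xss = List.map f (allFin m)} ps)) (∈-allFin i)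

lookup-ext : ∀ {A : Set} {m} {u v : Vec A m} → (∀ i → lookup u i ≡ lookup v i) → u ≡ v
lookup-ext {u = u} {v} p≡ = ≡.trans (sym (Vecₚ.tabulate∘lookup u))
  (≡.trans (Vecₚ.tabulate-cong p≡) (Vecₚ.tabulate∘lookup v))

allVec : ∀ {A : Set} → List A → ∀ m → List (Vec A m)
allVec xs zero    = [] ∷ []
allVec xs (suc m) = cartesianProductWith _∷_ xs (allVec xs m)

length-allVec : ∀ {A : Set} (xs : List A) m → length (allVec xs m) ≡ length xs ^ m
length-allVec xs zero    = refl
length-allVec xs (suc m) = ≡.trans (length-cartesianProductWith _∷_ xs (allVec xs m))
  (cong (length xs *_) (length-allVec xs m))

∈-allVec⁺ : ∀ {A : Set} {xs : List A} {m} (v : Vec A m) → (∀ i → lookup v i ∈ xs) → v ∈ allVec xs m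
∈-allVec⁺ []      v∈ = here refl
∈-allVec⁺ (a ∷ v) v∈ = ∈-cartesianProductWith⁺ _∷_ (v∈ zero) (∈-allVec⁺ v (v∈ ∘ suc))

∈-allVec⁻ : ∀ {A : Set} {xs : List A} {m} (v : Vec A m) → v ∈ allVec xs m → ∀ i → lookup v i ∈ xs
∈-allVec⁻ {xs = xs} {suc m} v v∈ i with ∈-cartesianProductWith⁻ _∷_ xs (allVec xs m) v∈
∈-allVec⁻ v v∈ zero    | _ , u , a∈ , u∈ , refl = a∈
∈-allVec⁻ v v∈ (suc i) | _ , u , a∈ , u∈ , refl = ∈-allVec⁻ u u∈ i

-- Strict upper triangles: one entry for each pair i < j.
Triangle : Set → ℕ → Set
Triangle A zero    = ⊤
Triangle A (suc m) = Vec A m × Triangle A m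

module _ {A : Set} (default : A) where

  entry : ∀ {m} → Triangle A m → Fin m → Fin m → A
  entry (row , rest) zero    zero    = default
  entry (row , rest) zero    (suc j) = lookup row j
  entry (row , rest) (suc i) zero    = default
  entry (row , rest) (suc i) (suc j) = entry rest i j

  triangle : ∀ m → (Fin m → Fin m → A) → Triangle A m
  triangle zero    f = _
  triangle (suc m) f = tabulate (λ j → f zero (suc j)) , triangle m (λ i j → f (suc i) (suc j))

  entry-triangle : ∀ {m} f i j → toℕ i < toℕ j → entry (triangle m f) i j ≡ f i j
  entry-triangle f zero    (suc j) _         = Vecₚ.lookup∘tabulate _ j
  entry-triangle f (suc i) (suc j) (s≤s i<j) = entry-triangle _ i j i<j

  triangle-unique : ∀ {m} (r : Triangle A m) f →
    (∀ i j → toℕ i < toℕ j → entry r i j ≡ f i j) → r ≡ triangle m f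
  triangle-unique {zero}  _            f p≡ = refl
  triangle-unique {suc m} (row , rest) f p≡ = cong₂ _,_
    (≡.trans (sym (Vecₚ.tabulate∘lookup row)) (Vecₚ.tabulate-cong λ j → p≡ zero (suc j) (s≤s z≤n)))
    (triangle-unique rest _ λ i j i<j → p≡ (suc i) (suc j) (s≤s i<j))

allTriangles : ∀ {A : Set} → List A → ∀ m → List (Triangle A m)
allTriangles xs zero    = _ ∷ []
allTriangles xs (suc m) = cartesianProduct (allVec xs m) (allTriangles xs m)

∈-allTriangles : ∀ {A : Set} {xs : List A} → (∀ a → a ∈ xs) →
  ∀ {m} (r : Triangle A m) → r ∈ allTriangles xs m
∈-allTriangles all {zero}  _            = here refl
∈-allTriangles all {suc m} (row , rest) =
  ∈-cartesianProduct⁺ (∈-allVec⁺ row (λ i → all _)) (∈-allTriangles all rest)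

-- The binomial coefficient "m choose 2".
pairs : ℕ → ℕ
pairs zero    = 0
pairs (suc m) = m + pairs m

length-allTriangles : ∀ {A : Set} (xs : List A) m → length (allTriangles xs m) ≡ length xs ^ pairs m
length-allTriangles xs zero    = refl
length-allTriangles xs (suc m) =
  ≡.trans (length-cartesianProductWith _,_ (allVec xs m) (allTriangles xs m))
    (≡.trans (cong₂ _*_ (length-allVec xs m) (length-allTriangles xs m))
      (sym (ℕₚ.^-distribˡ-+-* (length xs) m (pairs m))))

pairs-≤ : ∀ m → pairs m * 2 ≤ m * m
pairs-≤ zero    = z≤n
pairs-≤ (suc m) = begin
  (m + pairs m) * 2      ≡⟨ ℕₚ.*-distribʳ-+ 2 m (pairs m) ⟩
  m * 2 + pairs m * 2    ≤⟨ ℕₚ.+-monoʳ-≤ (m * 2) (pairs-≤ m) ⟩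
  m * 2 + m * m          ≤⟨ ℕₚ.n≤1+n _ ⟩
  1 + (m * 2 + m * m)    ≡⟨ square m ⟩
  suc m * suc m          ∎
  where
  open ℕₚ.≤-Reasoning
  square : ∀ m → 1 + (m * 2 + m * m) ≡ suc m * suc m
  square = solve-∀

pairs-double-≤ : ∀ β → pairs (β + β) ≤ 2 * (β * β)
pairs-double-≤ β = ℕₚ.*-cancelʳ-≤ _ _ 2 (ℕₚ.≤-trans (pairs-≤ (β + β)) (ℕₚ.≤-reflexive (p≡ β)))
  where
  p≡ : ∀ β → (β + β) * (β + β) ≡ 2 * (β * β) * 2
  p≡ = solve-∀

-- Comparison of values

ords : List Ord
ords = lt< ∷ eq= ∷ gt> ∷ []

∈-ords : ∀ o → o ∈ ords
∈-ords lt< = here refl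
∈-ords eq= = there (here refl)
∈-ords gt> = there (there (here refl))

order : ℤ → ℤ → Ord
order a b with ℤₚ.<-cmp a b
... | tri< _ _ _ = lt<
... | tri≈ _ _ _ = eq=
... | tri> _ _ _ = gt>

reverse : Ord → Ord
reverse lt< = gt>
reverse eq= = eq=
reverse gt> = lt<

-- Types store the comparison for `i` < `j` only; this recovers the other half.
order-reverse : ∀ a b → order a b ≡ reverse (order b a)
order-reverse a b with ℤₚ.<-cmp a b | ℤₚ.<-cmp b a
... | tri< _ _ _   | tri> _ _ _   = refl
... | tri≈ _ _ _   | tri≈ _ _ _   = refl
... | tri> _ _ _   | tri< _ _ _   = refl
... | tri< a<b _ _ | tri< _ _ ¬p  = ⊥-elim (¬p a<b)
... | tri< _ ¬p _  | tri≈ _ p _   = ⊥-elim (¬p (sym p))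
... | tri≈ _ p _   | tri< _ ¬p _  = ⊥-elim (¬p (sym p))
... | tri≈ _ p _   | tri> _ ¬p _  = ⊥-elim (¬p (sym p))
... | tri> _ ¬p _  | tri≈ _ p _   = ⊥-elim (¬p (sym p))
... | tri> ¬p _ _  | tri> _ _ p   = ⊥-elim (¬p p)

order-refl : ∀ a → order a a ≡ eq=
order-refl a with ℤₚ.<-cmp a a
... | tri< _ ¬p _ = ⊥-elim (¬p refl)
... | tri≈ _ _ _  = refl
... | tri> _ ¬p _ = ⊥-elim (¬p refl)

isLess isEqual : Ord → Bool
isLess lt<  = true
isLess _    = false
isEqual eq= = true
isEqual _   = false

⌊⌋-true : ∀ {P : Set} (P? : Dec P) → P → ⌊ P? ⌋ ≡ true
⌊⌋-true P? p = ≡.trans (isYes≗does P?) (dec-true P? p)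

⌊⌋-false : ∀ {P : Set} (P? : Dec P) → ¬ P → ⌊ P? ⌋ ≡ false
⌊⌋-false P? ¬p = ≡.trans (isYes≗does P?) (dec-false P? ¬p)

<ᵇ-order : ∀ a b → (a <ᵇℤ b) ≡ isLess (order a b)
<ᵇ-order a b with ℤₚ.<-cmp a b
... | tri< p _ _  = ⌊⌋-true (a ℤ.<? b) p
... | tri≈ ¬p _ _ = ⌊⌋-false (a ℤ.<? b) ¬p
... | tri> ¬p _ _ = ⌊⌋-false (a ℤ.<? b) ¬p

≡ᵇ-order : ∀ a b → (a ≡ᵇℤ b) ≡ isEqual (order a b)
≡ᵇ-order a b with ℤₚ.<-cmp a b
... | tri< _ ¬p _ = ⌊⌋-false (a ℤ.≟ b) ¬p
... | tri≈ _ p _  = ⌊⌋-true (a ℤ.≟ b) p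
... | tri> _ ¬p _ = ⌊⌋-false (a ℤ.≟ b) ¬p

module _ {β} (z z' : Vec ℤ β) where

  relC-eval : ∀ t u → T (eval (relC t u (order (evalT z z' t) (evalT z z' u))) z z')
  relC-eval t u with ℤₚ.<-cmp (evalT z z' t) (evalT z z' u)
  ... | tri< p _ _ = fromWitness p
  ... | tri≈ _ p _ = fromWitness p
  ... | tri> _ _ p = fromWitness p

  relC-unique : ∀ t u o → T (eval (relC t u o) z z') → o ≡ order (evalT z z' t) (evalT z z' u)
  relC-unique t u o h with ℤₚ.<-cmp (evalT z z' t) (evalT z z' u)
  relC-unique t u lt< h | tri< _ _ _   = refl
  relC-unique t u lt< h | tri≈ ¬p _ _  = ⊥-elim (¬p (toWitness h))
  relC-unique t u lt< h | tri> ¬p _ _  = ⊥-elim (¬p (toWitness h))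
  relC-unique t u eq= h | tri< _ ¬p _  = ⊥-elim (¬p (toWitness h))
  relC-unique t u eq= h | tri≈ _ _ _   = refl
  relC-unique t u eq= h | tri> _ ¬p _  = ⊥-elim (¬p (toWitness h))
  relC-unique t u gt> h | tri< _ _ ¬p  = ⊥-elim (¬p (toWitness h))
  relC-unique t u gt> h | tri≈ _ _ ¬p  = ⊥-elim (¬p (toWitness h))
  relC-unique t u gt> h | tri> _ _ _   = refl

  Holds : Constraint β → Set
  Holds φ = T (eval φ z z')

  conj⁺ : ∀ {φs} → All Holds φs → Holds (conj φs)
  conj⁺ []       = _
  conj⁺ (h ∷ hs) = Equivalence.from Boolₚ.T-∧ (h , conj⁺ hs)

  conj⁻ : ∀ φs → Holds (conj φs) → All Holds φs
  conj⁻ []       _ = []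
  conj⁻ (φ ∷ φs) h = let h₁ , h₂ = Equivalence.to Boolₚ.T-∧ h in h₁ ∷ conj⁻ φs h₂

index : ∀ {β} → Term β → Fin (β + β)
index {β} (x j)  = j ↑ˡ β
index {β} (x' j) = β ↑ʳ j

var-index : ∀ {β} (t : Term β) → var (index t) ≡ t
var-index {β} (x j)  rewrite Finₚ.splitAt-↑ˡ β j β = refl
var-index {β} (x' j) rewrite Finₚ.splitAt-↑ʳ β β j = refl

conj-size : ∀ {β} k {φs : List (Constraint β)} → All (λ φ → size φ ≤ k) φs →
  size (conj φs) ≤ suc (length φs * suc k)
conj-size k []             = ℕₚ.≤-refl
conj-size k {φ ∷ φs} (h ∷ hs) = s≤s (ℕₚ.≤-trans (ℕₚ.+-mono-≤ h (conj-size k hs))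
  (ℕₚ.≤-reflexive (ℕₚ.+-suc k (length φs * suc k))))

-- A nonnegative `d` is bounded by the upper end, a negative one by the lower end.
∣d∣≤ : ∀ {a b d} → a ℤ.≤ d → d ℤ.≤ b → ∣ d ∣ ≤ ∣ a ∣ ⊔ ∣ b ∣
∣d∣≤ {a} {d = + n}      _         (+≤+ n≤m) = ℕₚ.≤-trans n≤m (ℕₚ.m≤n⊔m ∣ a ∣ _)
∣d∣≤ {b = b} {d = -[1+ n ]} (-≤- n≤m) _         = ℕₚ.≤-trans (s≤s n≤m) (ℕₚ.m≤m⊔n _ ∣ b ∣)

-- Bridges `bitsize`, which takes the logarithm of the successor of the absolute value, and
-- `paramN`, which does not; for positive `m` the successor is at most `2 * m`.
log-suc : ∀ m → ⌈log₂ suc m ⌉ ≤ suc ⌈log₂ m ⌉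
log-suc zero    = z≤n
log-suc (suc m) = ℕₚ.≤-trans
  (⌈log₂⌉-mono-≤ {suc (suc m)} {2 * suc m}
    (s≤s (ℕₚ.≤-trans (ℕₚ.≤-reflexive (sym (ℕₚ.+-identityʳ (suc m)))) (ℕₚ.m≤n+m _ m))))
  (ℕₚ.≤-reflexive (⌈log₂2*n⌉≡1+⌈log₂n⌉ (suc m)))

log-⊔ : ∀ m n → ⌈log₂ (m ⊔ n) ⌉ ≤ ⌈log₂ m ⌉ ⊔ ⌈log₂ n ⌉
log-⊔ m n with ℕₚ.⊔-sel m n
... | inj₁ p≡ rewrite p≡ = ℕₚ.m≤m⊔n _ _
... | inj₂ p≡ rewrite p≡ = ℕₚ.m≤n⊔m ⌈log₂ m ⌉ _

bitsize-≤ : ∀ {a b d} → a ℤ.≤ d → d ℤ.≤ b → bitsize d ≤ 2 + (⌈log₂ ∣ a ∣ ⌉ ⊔ ⌈log₂ ∣ b ∣ ⌉)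
bitsize-≤ {a} {b} {d} a≤d d≤b = s≤s (ℕₚ.≤-trans (log-suc ∣ d ∣)
  (s≤s (ℕₚ.≤-trans (⌈log₂⌉-mono-≤ (∣d∣≤ a≤d d≤b)) (log-⊔ ∣ a ∣ ∣ b ∣))))

-- Enumeration of the types and of what they decide

module Types (β : ℕ) {a b : ℤ} (a≤b : a ℤ.≤ b) where

  classify : ℤ → CST
  classify v with v ℤ.<? a | b ℤ.<? v
  ... | yes _ | _     = below
  ... | no _  | yes _ = above
  ... | no _  | no _  = equal v

  csts : List CST
  csts = below ∷ above ∷ List.map (λ i → equal (a ℤ.+ + i)) (upTo (suc ∣ b - a ∣))

  length-csts : length csts ≡ ∣ b - a ∣ + 3
  length-csts = ≡.trans (cong (λ l → suc (suc l)) (≡.trans (Listₚ.length-map _ (upTo (suc ∣ b - a ∣)))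
    (Listₚ.length-upTo (suc ∣ b - a ∣)))) (ℕₚ.+-comm 3 ∣ b - a ∣)

  a+∣v-a∣ : ∀ {v} → a ℤ.≤ v → a ℤ.+ + ∣ v - a ∣ ≡ v
  a+∣v-a∣ {v} a≤v rewrite ℤₚ.0≤i⇒+∣i∣≡i (ℤₚ.i≤j⇒0≤j-i a≤v) =
    ≡.trans (ℤₚ.+-comm a (v - a)) (≡.trans (ℤₚ.+-assoc v (ℤ.- a) a)
      (≡.trans (cong (λ u → v ℤ.+ u) (ℤₚ.+-inverseˡ a)) (ℤₚ.+-identityʳ v)))

  equal-∈csts⁺ : ∀ {v} → a ℤ.≤ v → v ℤ.≤ b → equal v ∈ csts
  equal-∈csts⁺ {v} a≤v v≤b = there (there (subst (λ u → equal u ∈ _) (a+∣v-a∣ a≤v)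
    (∈-map⁺ (λ i → equal (a ℤ.+ + i)) (∈-upTo⁺ (s≤s (ℤₚ.drop‿+≤+ (subst₂ ℤ._≤_
      (sym (ℤₚ.0≤i⇒+∣i∣≡i (ℤₚ.i≤j⇒0≤j-i a≤v))) (sym (ℤₚ.0≤i⇒+∣i∣≡i (ℤₚ.i≤j⇒0≤j-i a≤b)))
      (ℤₚ.+-monoˡ-≤ (ℤ.- a) v≤b))))))))

  equal-∈csts⁻ : ∀ {d} → equal d ∈ csts → a ℤ.≤ d × d ℤ.≤ b
  equal-∈csts⁻ (there (there d∈)) with ∈-map⁻ (λ i → equal (a ℤ.+ + i)) d∈
  ... | i , i∈ , refl = ℤₚ.i≤i+j a (+ i) ,
    subst (a ℤ.+ + i ℤ.≤_) (a+∣v-a∣ a≤b) (ℤₚ.+-monoʳ-≤ a (+≤+ (ℕₚ.≤-pred (∈-upTo⁻ i∈))))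

  classify-∈csts : ∀ v → classify v ∈ csts
  classify-∈csts v with v ℤ.<? a | b ℤ.<? v
  ... | yes _ | _     = here refl
  ... | no _  | yes _ = there (here refl)
  ... | no v≮a | no b≮v = equal-∈csts⁺ (ℤₚ.≮⇒≥ v≮a) (ℤₚ.≮⇒≥ b≮v)

  hits : ℤ → CST → Bool
  hits d (equal e) = e ≡ᵇℤ d
  hits d _         = false

  -- A value outside the interval differs from every constant inside it, and a value inside is
  -- recorded exactly.
  ≡ᵇ-classify : ∀ {d} → a ℤ.≤ d → d ℤ.≤ b → ∀ v → (v ≡ᵇℤ d) ≡ hits d (classify v)
  ≡ᵇ-classify {d} a≤d d≤b v with v ℤ.<? a | b ℤ.<? v
  ... | yes v<a | _       = ⌊⌋-false (v ℤ.≟ d) λ where refl → ℤₚ.<⇒≱ v<a a≤d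
  ... | no _    | yes b<v = ⌊⌋-false (v ℤ.≟ d) λ where refl → ℤₚ.<⇒≱ b<v d≤b
  ... | no _    | no _    = refl

  module _ (z z' : Vec ℤ β) where

    cstC-eval : ∀ t → T (eval (cstC a b t (classify (evalT z z' t))) z z')
    cstC-eval t with evalT z z' t ℤ.<? a in eq₁ | b ℤ.<? evalT z z' t in eq₂
    ... | yes _ | _     rewrite eq₁ = _
    ... | no _  | yes _ rewrite eq₂ = _
    ... | no _  | no _  = fromWitness {a? = _ ℤ.≟ _} refl

    cstC-unique : ∀ t c → c ∈ csts → T (eval (cstC a b t c) z z') → c ≡ classify (evalT z z' t)
    cstC-unique t c c∈ h with evalT z z' t ℤ.<? a | b ℤ.<? evalT z z' t
    cstC-unique t below c∈ h | yes _ | _ = refl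
    cstC-unique t above c∈ h | yes v<a | _ =
      ⊥-elim (ℤₚ.<-asym (ℤₚ.<-≤-trans v<a a≤b) (toWitness h))
    cstC-unique t (equal d) c∈ h | yes v<a | _ = ⊥-elim (ℤₚ.<⇒≱ v<a
      (subst (a ℤ.≤_) (sym (toWitness h)) (proj₁ (equal-∈csts⁻ c∈))))
    cstC-unique t below c∈ h | no v≮a | _ = ⊥-elim (v≮a (toWitness h))
    cstC-unique t above c∈ h | no v≮a | yes _ = refl
    cstC-unique t (equal d) c∈ h | no v≮a | yes b<v = ⊥-elim (ℤₚ.<⇒≱ b<v
      (subst (ℤ._≤ b) (sym (toWitness h)) (proj₂ (equal-∈csts⁻ c∈))))
    cstC-unique t above c∈ h | no v≮a | no b≮v = ⊥-elim (b≮v (toWitness h))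
    cstC-unique t (equal d) c∈ h | no v≮a | no b≮v = cong equal (sym (toWitness h))

  -- Types as finite tables: with the functions of `Type`, uniqueness would require extensionality
  -- and fixed values of `rel` outside the strict triangle.
  Code : Set
  Code = Vec CST (β + β) × Triangle Ord (β + β)

  codes : List Code
  codes = cartesianProduct (allVec csts (β + β)) (allTriangles ords (β + β))

  toType : Code → Type β
  toType (cs , r) = record { cst = lookup cs ; rel = entry eq= r }

  constraint : Code → Constraint β
  constraint c = typeConstraint a b (toType c)

  codeOf : Vec ℤ β → Vec ℤ β → Code
  codeOf z z' = tabulate (λ i → classify (evalT z z' (var i))) ,
    triangle eq= (β + β) (λ i j → order (evalT z z' (var i)) (evalT z z' (var j)))

  codeOf-∈ : ∀ z z' → codeOf z z' ∈ codes
  codeOf-∈ z z' = ∈-cartesianProduct⁺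
    (∈-allVec⁺ _ λ i → subst (_∈ csts) (sym (Vecₚ.lookup∘tabulate _ i)) (classify-∈csts _))
    (∈-allTriangles ∈-ords _)

  length-codes : length codes ≤ (∣ b - a ∣ + 3) ^ (2 * β) * 3 ^ (2 * (β * β))
  length-codes = begin
    length codes
      ≡⟨ length-cartesianProductWith _,_ (allVec csts (β + β)) (allTriangles ords (β + β)) ⟩
    length (allVec csts (β + β)) * length (allTriangles ords (β + β))
      ≡⟨ cong₂ _*_ (length-allVec csts (β + β)) (length-allTriangles ords (β + β)) ⟩
    length csts ^ (β + β) * 3 ^ pairs (β + β)
      ≡⟨ cong₂ (λ m k → m ^ k * 3 ^ pairs (β + β)) length-csts
           (cong (λ γ → β + γ) (sym (ℕₚ.+-identityʳ β))) ⟩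
    (∣ b - a ∣ + 3) ^ (2 * β) * 3 ^ pairs (β + β)
      ≤⟨ ℕₚ.*-monoʳ-≤ ((∣ b - a ∣ + 3) ^ (2 * β)) (ℕₚ.^-monoʳ-≤ 3 (pairs-double-≤ β)) ⟩
    (∣ b - a ∣ + 3) ^ (2 * β) * 3 ^ (2 * (β * β)) ∎
    where open ℕₚ.≤-Reasoning

  ∈-codes⇒∈-csts : ∀ {c} → c ∈ codes → ∀ i → lookup (proj₁ c) i ∈ csts
  ∈-codes⇒∈-csts {c} c∈ = ∈-allVec⁻ (proj₁ c) (proj₁ (∈-cartesianProduct⁻ _ _ c∈))

  wellFormed : ∀ {c} → c ∈ codes → WFType a b (toType c)
  wellFormed c∈ i d p≡ = equal-∈csts⁻ (subst (_∈ csts) p≡ (∈-codes⇒∈-csts c∈ i))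

  -- Spelled like the corresponding part of `typeConstraint`, so that `constraint c` unfolds to
  -- conjunctions over `memberships c` and `comparisons c`.
  comparison : Code → Fin (β + β) → Fin (β + β) → List (Constraint β)
  comparison (_ , r) i j = if toℕ i ℕ.<ᵇ toℕ j then relC (var i) (var j) (entry eq= r i j) ∷ [] else []

  All-comparison : ∀ {P : Constraint β → Set} c i j →
    (toℕ i < toℕ j → P (relC (var i) (var j) (entry eq= (proj₂ c) i j))) → All P (comparison c i j)
  All-comparison c i j p with toℕ i ℕ.<ᵇ toℕ j in p≡
  ... | true  = p (ℕₚ.<ᵇ⇒< (toℕ i) (toℕ j) (subst T (sym p≡) _)) ∷ []
  ... | false = []

  All-comparison⁻ : ∀ {P : Constraint β → Set} c i j → All P (comparison c i j) → toℕ i < toℕ j →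
    P (relC (var i) (var j) (entry eq= (proj₂ c) i j))
  All-comparison⁻ c i j ps i<j with toℕ i ℕ.<ᵇ toℕ j | ℕₚ.<⇒<ᵇ i<j | ps
  ... | true | _ | p ∷ [] = p

  comparisons : Code → List (Constraint β)
  comparisons c = concatMap (λ i → concatMap (comparison c i) (allFin (β + β))) (allFin (β + β))

  All-comparisons : ∀ {P : Constraint β → Set} c →
    (∀ i j → toℕ i < toℕ j → P (relC (var i) (var j) (entry eq= (proj₂ c) i j))) → All P (comparisons c)
  All-comparisons c p = concatMap-allFin⁺ (λ i → concatMap (comparison c i) (allFin (β + β)))
    λ i → concatMap-allFin⁺ (comparison c i) λ j → All-comparison c i j (p i j)

  All-comparisons⁻ : ∀ {P : Constraint β → Set} c → All P (comparisons c) → ∀ i j → toℕ i < toℕ j →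
    P (relC (var i) (var j) (entry eq= (proj₂ c) i j))
  All-comparisons⁻ c ps i j = All-comparison⁻ c i j (concatMap-allFin⁻ (comparison c i)
    (concatMap-allFin⁻ (λ i → concatMap (comparison c i) (allFin (β + β))) ps i) j)

  membership : Code → Fin (β + β) → Constraint β
  membership c i = cstC a b (var i) (lookup (proj₁ c) i)

  memberships : Code → List (Constraint β)
  memberships c = List.map (membership c) (allFin (β + β))

  constraint-codeOf : ∀ z z' → T (eval (constraint (codeOf z z')) z z')
  constraint-codeOf z z' = Equivalence.from Boolₚ.T-∧
    ( conj⁺ z z' (map-allFin⁺ (membership (codeOf z z')) λ i →
        subst (λ k → T (eval (cstC a b (var i) k) z z'))
          (sym (Vecₚ.lookup∘tabulate (λ i → classify (evalT z z' (var i))) i)) (cstC-eval z z' (var i)))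
    , conj⁺ z z' (All-comparisons (codeOf z z') λ i j i<j →
        subst (λ o → T (eval (relC (var i) (var j) o) z z'))
          (sym (entry-triangle eq= _ i j i<j)) (relC-eval z z' (var i) (var j))))

  -- The alternatives of each clause exclude one another, so a valuation satisfies a single code;
  -- determinism rests on this.
  code-unique : ∀ {c} → c ∈ codes → ∀ z z' → T (eval (constraint c) z z') → c ≡ codeOf z z'
  code-unique {c} c∈ z z' h = let h₁ , h₂ = Equivalence.to Boolₚ.T-∧ h in cong₂ _,_
    (lookup-ext λ i → ≡.trans (cstC-unique z z' (var i) _ (∈-codes⇒∈-csts c∈ i)
      (map-allFin⁻ (membership c) (conj⁻ z z' (memberships c) h₁) i))
      (sym (Vecₚ.lookup∘tabulate _ i)))
    (triangle-unique eq= (proj₂ c) _ λ i j i<j → relC-unique z z' (var i) (var j) _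
      (All-comparisons⁻ c (conj⁻ z z' (comparisons c) h₂) i j i<j))

  module Agree {z z' y y' : Vec ℤ β} (same : codeOf z z' ≡ codeOf y y') where

    classify-agree : ∀ t → classify (evalT z z' t) ≡ classify (evalT y y' t)
    classify-agree t = subst (λ t → classify (evalT z z' t) ≡ classify (evalT y y' t)) (var-index t)
      (≡.trans (sym (Vecₚ.lookup∘tabulate _ (index t)))
        (≡.trans (cong (λ c → lookup (proj₁ c) (index t)) same) (Vecₚ.lookup∘tabulate _ (index t))))

    order-var : ∀ i j → toℕ i < toℕ j →
      order (evalT z z' (var i)) (evalT z z' (var j)) ≡ order (evalT y y' (var i)) (evalT y y' (var j))
    order-var i j i<j = ≡.trans (sym (entry-triangle eq= _ i j i<j))
      (≡.trans (cong (λ c → entry eq= (proj₂ c) i j) same) (entry-triangle eq= _ i j i<j))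

    order-all : ∀ i j →
      order (evalT z z' (var i)) (evalT z z' (var j)) ≡ order (evalT y y' (var i)) (evalT y y' (var j))
    order-all i j with ℕₚ.<-cmp (toℕ i) (toℕ j)
    ... | tri< i<j _ _ = order-var i j i<j
    ... | tri≈ _ i≡j _ rewrite Finₚ.toℕ-injective i≡j =
      ≡.trans (order-refl (evalT z z' (var j))) (sym (order-refl (evalT y y' (var j))))
    ... | tri> _ _ j<i = ≡.trans (order-reverse _ (evalT z z' (var j)))
      (≡.trans (cong reverse (order-var j i j<i)) (sym (order-reverse _ (evalT y y' (var j)))))

    order-agree : ∀ t u → order (evalT z z' t) (evalT z z' u) ≡ order (evalT y y' t) (evalT y y' u)
    order-agree t u = subst₂
      (λ t u → order (evalT z z' t) (evalT z z' u) ≡ order (evalT y y' t) (evalT y y' u))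
      (var-index t) (var-index u) (order-all (index t) (index u))

    -- Every basic atom factors through the code: comparisons of terms through `order`, equations
    -- with constants through `classify`.
    eval-agree : ∀ φ → Basic φ → (∀ d → d ∈ consts φ → a ℤ.≤ d × d ℤ.≤ b) →
      eval φ z z' ≡ eval φ y y'
    eval-agree tt        _       _  = refl
    eval-agree ff        _       _  = refl
    eval-agree (lt t u)  _       _  = ≡.trans (<ᵇ-order (evalT z z' t) (evalT z z' u))
      (≡.trans (cong isLess (order-agree t u)) (sym (<ᵇ-order (evalT y y' t) (evalT y y' u))))
    eval-agree (eq t u)  _       _  = ≡.trans (≡ᵇ-order (evalT z z' t) (evalT z z' u))
      (≡.trans (cong isEqual (order-agree t u)) (sym (≡ᵇ-order (evalT y y' t) (evalT y y' u))))
    eval-agree (eqc t d) _       in-range = let a≤d , d≤b = in-range d (here refl) in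
      ≡.trans (≡ᵇ-classify a≤d d≤b (evalT z z' t))
        (≡.trans (cong (hits d) (classify-agree t)) (sym (≡ᵇ-classify a≤d d≤b (evalT y y' t))))
    eval-agree (neg φ)   basic   in-range = cong not (eval-agree φ basic in-range)
    eval-agree (φ & ψ)   (bφ , bψ) in-range = cong₂ _∧_
      (eval-agree φ bφ λ d d∈ → in-range d (∈-++⁺ˡ d∈))
      (eval-agree ψ bψ λ d d∈ → in-range d (∈-++⁺ʳ (consts φ) d∈))
    eval-agree (φ ∣∣ ψ)  (bφ , bψ) in-range = cong₂ _∨_
      (eval-agree φ bφ λ d d∈ → in-range d (∈-++⁺ˡ d∈))
      (eval-agree ψ bψ λ d d∈ → in-range d (∈-++⁺ʳ (consts φ) d∈))

  -- The successor makes it positive, so that additive constants are absorbed by multiples of `N`.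
  N : ℕ
  N = suc (paramN β a b)

  cstC-size : ∀ (t : Term β) c → c ∈ csts → size (cstC a b t c) ≤ 3 + N
  cstC-size t c c∈ = ℕₚ.≤-trans (go c c∈) (ℕₚ.+-monoʳ-≤ 4 (ℕₚ.m≤n+m _ β))
    where
    go : ∀ c → c ∈ csts → size (cstC a b t c) ≤ 4 + (⌈log₂ ∣ a ∣ ⌉ ⊔ ⌈log₂ ∣ b ∣ ⌉)
    go below     _  = ℕₚ.+-monoʳ-≤ 2 (bitsize-≤ ℤₚ.≤-refl a≤b)
    go above     _  = ℕₚ.+-monoʳ-≤ 2 (bitsize-≤ a≤b ℤₚ.≤-refl)
    go (equal d) c∈ = ℕₚ.+-monoʳ-≤ 2 (let a≤d , d≤b = equal-∈csts⁻ c∈ in bitsize-≤ a≤d d≤b)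

  relC-size : ∀ (t u : Term β) o → size (relC t u o) ≤ 3
  relC-size t u lt< = ℕₚ.≤-refl
  relC-size t u eq= = ℕₚ.≤-refl
  relC-size t u gt> = ℕₚ.≤-refl

  length-comparison : ∀ c i j → length (comparison c i j) ≤ 1
  length-comparison c i j with toℕ i ℕ.<ᵇ toℕ j
  ... | true  = ℕₚ.≤-refl
  ... | false = z≤n

  length-allFin : ∀ m → length (allFin m) ≡ m
  length-allFin m = Listₚ.length-tabulate {n = m} (λ i → i)

  length-comparisons : ∀ c → length (comparisons c) ≤ (β + β) * (β + β)
  length-comparisons c = subst (λ m → length (comparisons c) ≤ m * (β + β)) (length-allFin (β + β))
    (length-concatMap-≤ _ (β + β) (λ i → subst (length (concatMap (comparison c i) (allFin (β + β))) ≤_)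
      (≡.trans (ℕₚ.*-identityʳ _) (length-allFin (β + β)))
      (length-concatMap-≤ (comparison c i) 1 (length-comparison c i) (allFin (β + β)))) (allFin (β + β)))

  -- There are 2β memberships of linear size and at most (2β)² comparisons of constant size: 2N · 5N
  -- + 2N · 2N · 4 + 3, which is at most 29N².
  constraint-size : ∀ {c} → c ∈ codes → size (constraint c) ≤ 29 * N ^ 3
  constraint-size {c} c∈ = begin
    suc (size (conj (memberships c)) + size (conj (comparisons c)))
      ≤⟨ s≤s (ℕₚ.+-mono-≤
           (conj-size (3 + N) (map-allFin⁺ (membership c) λ i → cstC-size (var i) _ (∈-codes⇒∈-csts c∈ i)))
           (conj-size 3 (All-comparisons c λ i j _ →
             relC-size (var i) (var j) (entry eq= (proj₂ c) i j)))) ⟩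
    suc (suc (length (memberships c) * (4 + N)) + suc (length (comparisons c) * 4))
      ≤⟨ s≤s (ℕₚ.+-mono-≤ (s≤s (ℕₚ.*-monoˡ-≤ (4 + N) (ℕₚ.≤-reflexive
           (≡.trans (Listₚ.length-map _ (allFin (β + β))) (length-allFin (β + β))))))
           (s≤s (ℕₚ.*-monoˡ-≤ 4 (length-comparisons c)))) ⟩
    suc (suc ((β + β) * (4 + N)) + suc ((β + β) * (β + β) * 4))
      ≤⟨ s≤s (ℕₚ.+-mono-≤
           (s≤s (ℕₚ.*-mono-≤ (ℕₚ.+-mono-≤ β≤N β≤N) (ℕₚ.+-monoˡ-≤ N {4} {4 * N} (ℕₚ.m≤m*n 4 N))))
           (s≤s (ℕₚ.*-monoˡ-≤ 4 (ℕₚ.*-mono-≤ (ℕₚ.+-mono-≤ β≤N β≤N) (ℕₚ.+-mono-≤ β≤N β≤N))))) ⟩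
    suc (suc ((N + N) * (4 * N + N)) + suc ((N + N) * (N + N) * 4))
      ≡⟨ simplify N ⟩
    26 * (N * N) + 3
      ≤⟨ ℕₚ.+-monoʳ-≤ (26 * (N * N)) (ℕₚ.*-monoʳ-≤ 3 (s≤s {0} {_} z≤n)) ⟩
    26 * (N * N) + 3 * (N * N)
      ≡⟨ ℕₚ.*-distribʳ-+ (N * N) 26 3 ⟨
    29 * (N * N)
      ≤⟨ ℕₚ.*-monoʳ-≤ 29 (ℕₚ.*-monoʳ-≤ N (ℕₚ.m≤m*n N (N * 1))) ⟩
    29 * N ^ 3 ∎
    where
    open ℕₚ.≤-Reasoning
    β≤N : β ≤ N
    β≤N = ℕₚ.m≤n⇒m≤1+n (ℕₚ.m≤m+n β _)
    simplify : ∀ N → suc (suc ((N + N) * (4 * N + N)) + suc ((N + N) * (N + N) * 4)) ≡ 26 * (N * N) + 3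
    simplify = solve-∀

last-lookup : ∀ {A : Set} {k} (v : Vec A (suc k)) → last v ≡ lookup v (fromℕ k)
last-lookup (a ∷ [])    = refl
last-lookup (a ∷ b ∷ v) = last-lookup (b ∷ v)

lookup-zero : ∀ {A : Set} {k} (v : Vec A (suc k)) → lookup v zero ≡ head v
lookup-zero (_ ∷ _) = refl

head-∈ : ∀ {A : Set} {k} (v : Vec A (suc k)) → head v ∈ toList v
head-∈ (_ ∷ _) = here refl

module _ {k} (ds : Vec ℤ (suc k)) (increasing : StrictlyIncreasing ds) where

  head-≤ : ∀ {d} → d ∈ toList ds → head ds ℤ.≤ d
  head-≤ d∈ with ∈-toList⁻ ds d∈
  ... | zero  , refl = ℤₚ.≤-reflexive (sym (lookup-zero ds))
  ... | suc i , refl = subst (ℤ._≤ lookup ds (suc i)) (lookup-zero ds)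
    (ℤₚ.<⇒≤ (increasing zero (suc i) (s≤s z≤n)))

  ≤-last : ∀ {d} → d ∈ toList ds → d ℤ.≤ last ds
  ≤-last d∈ with ∈-toList⁻ ds d∈
  ... | i , refl rewrite last-lookup ds with ℕₚ.m≤n⇒m<n∨m≡n (Finₚ.≤fromℕ i)
  ...   | inj₁ i<k = ℤₚ.<⇒≤ (increasing i (fromℕ k) i<k)
  ...   | inj₂ i≡k = ℤₚ.≤-reflexive (cong (lookup ds) (Finₚ.toℕ-injective i≡k))

  head≤last : head ds ℤ.≤ last ds
  head≤last = ≤-last (head-∈ ds)

-- The deterministic Rabin automaton

module _ {A B : Set} (f : A → Maybe B) where

  ∈-mapMaybe⁺ : ∀ {as a b} → a ∈ as → f a ≡ just b → b ∈ mapMaybe f as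
  ∈-mapMaybe⁺ {a ∷ as} (here refl) p≡ with f a
  ∈-mapMaybe⁺ {a ∷ as} (here refl) refl | just _ = here refl
  ∈-mapMaybe⁺ {a ∷ as} (there a∈)  p≡ with f a
  ... | just _  = there (∈-mapMaybe⁺ a∈ p≡)
  ... | nothing = ∈-mapMaybe⁺ a∈ p≡

  ∈-mapMaybe⁻ : ∀ {as b} → b ∈ mapMaybe f as → ∃ λ a → a ∈ as × f a ≡ just b
  ∈-mapMaybe⁻ {a ∷ as} b∈ with f a in p≡
  ∈-mapMaybe⁻ {a ∷ as} (here refl) | just _ = a , here refl , p≡
  ∈-mapMaybe⁻ {a ∷ as} (there b∈)  | just _ = let a′ , a∈ , q≡ = ∈-mapMaybe⁻ b∈ in a′ , there a∈ , q≡
  ∈-mapMaybe⁻ {a ∷ as} b∈          | nothing = let a′ , a∈ , q≡ = ∈-mapMaybe⁻ b∈ in a′ , there a∈ , q≡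

-- States as numbers

module _ {A : Set} {N : ℕ} (enc : A → Fin N) (dec : Fin N → A) where

  encodeVec : ∀ {m} → Vec A m → Fin (N ^ m)
  encodeVec []      = zero
  encodeVec (a ∷ v) = combine (enc a) (encodeVec v)

  decodeVec : ∀ {m} → Fin (N ^ m) → Vec A m
  decodeVec {zero}  _ = []
  decodeVec {suc m} i = let j , k = remQuot {N} (N ^ m) i in dec j ∷ decodeVec k

  decode-encodeVec : (∀ a → dec (enc a) ≡ a) → ∀ {m} (v : Vec A m) → decodeVec (encodeVec v) ≡ v
  decode-encodeVec dec-enc []              = refl
  decode-encodeVec dec-enc {suc m} (a ∷ v) = cong₂ _∷_
    (≡.trans (cong (λ jk → dec (proj₁ jk)) split≡) (dec-enc a))
    (≡.trans (cong (λ jk → decodeVec (proj₂ jk)) split≡) (decode-encodeVec dec-enc v))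
    where
    split≡ : remQuot {N} (N ^ m) (combine (enc a) (encodeVec v)) ≡ (enc a , encodeVec v)
    split≡ = Finₚ.remQuot-combine (enc a) (encodeVec v)

encodeBool : Bool → Fin 2
encodeBool false = zero
encodeBool true  = suc zero

decodeBool : Fin 2 → Bool
decodeBool zero    = false
decodeBool (suc _) = true

decode-encodeBool : ∀ b → decodeBool (encodeBool b) ≡ b
decode-encodeBool false = refl
decode-encodeBool true  = refl

module _ {n : ℕ} where

  encodeSubset : Subset n → Fin (2 ^ n)
  encodeSubset = encodeVec encodeBool decodeBool

  decodeSubset : Fin (2 ^ n) → Subset n
  decodeSubset = decodeVec encodeBool decodeBool

  -- The flags greens and bads of the last step, followed by the family.
  State : Set
  State = Vec (Subset n) (3 + n)

  abstract
    encode : State → Fin ((2 ^ n) ^ (3 + n))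
    encode = encodeVec encodeSubset decodeSubset

    decode : Fin ((2 ^ n) ^ (3 + n)) → State
    decode = decodeVec encodeSubset decodeSubset

    decode-encode : ∀ S → decode (encode S) ≡ S
    decode-encode = decode-encodeVec encodeSubset decodeSubset
      (decode-encodeVec encodeBool decodeBool decode-encodeBool)

  greenFlags badFlags : State → Subset n
  greenFlags (g ∷ b ∷ V) = g
  badFlags   (g ∷ b ∷ V) = b

  family : State → Family n
  family (g ∷ b ∷ V) = V

∈⇔T : ∀ {n} {P : Subset n} {q} → q ∈ₛ P ⇔ T (lookup P q)
∈⇔T {P = P} {q} = mk⇔ (λ q∈ → Equivalence.from Boolₚ.T-≡ (Vecₚ.[]=⇒lookup q∈))
  (λ t → Vecₚ.lookup⇒[]= q P (Equivalence.to Boolₚ.T-≡ t))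

∉⇔Tnot : ∀ {n} {P : Subset n} {q} → q ∉ₛ P ⇔ T (not (lookup P q))
∉⇔Tnot {P = P} {q} = mk⇔ (to (lookup P q) refl) λ t q∈ → from t (Vecₚ.[]=⇒lookup q∈)
  where
  to : ∀ b → lookup P q ≡ b → q ∉ₛ P → T (not b)
  to false _  _  = _
  to true  p≡ q∉ = q∉ (Vecₚ.lookup⇒[]= q P p≡)
  from : T (not (lookup P q)) → lookup P q ≡ true → ⊥
  from t p≡ rewrite p≡ = t

-- The exponent n(n + 3) is at most 3(n + 1)². The constant is left open because the theorem shares
-- it with the size bound on constraints.
states-≤ : ∀ n c → 3 ≤ c → (2 ^ n) ^ (3 + n) ≤ 2 ^ (c * suc n ^ c)
states-≤ n c 3≤c = begin
  (2 ^ n) ^ (3 + n)   ≡⟨ ℕₚ.^-*-assoc 2 n (3 + n) ⟩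
  2 ^ (n * (3 + n))   ≤⟨ ℕₚ.^-monoʳ-≤ 2 exponent ⟩
  2 ^ (c * suc n ^ c) ∎
  where
  open ℕₚ.≤-Reasoning
  expand : ∀ n → n * (3 + n) + (3 + 3 * n + 2 * (n * n)) ≡ 3 * (suc n * (suc n * 1))
  expand = solve-∀
  exponent : n * (3 + n) ≤ c * suc n ^ c
  exponent = begin
    n * (3 + n)      ≤⟨ ℕₚ.m≤m+n _ (3 + 3 * n + 2 * (n * n)) ⟩
    n * (3 + n) + (3 + 3 * n + 2 * (n * n)) ≡⟨ expand n ⟩
    3 * suc n ^ 2    ≤⟨ ℕₚ.*-mono-≤ 3≤c (ℕₚ.^-monoʳ-≤ (suc n) (ℕₚ.≤-trans (ℕₚ.n≤1+n 2) 3≤c)) ⟩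
    c * suc n ^ c    ∎

-- Transitions labelled by types

module Determinise (em : ExcludedMiddle 0ℓ) {s β k : ℕ} (ds : Vec ℤ (suc k))
  (increasing : StrictlyIncreasing ds) (A : Buchi s β) (involves : Involves ds (Buchi.aut A)) where

  open Classical em
  open CA (Buchi.aut A) renaming (nQ to n)
  open Types β (head≤last ds increasing)
  open Families em {n}

  I F : Subset n
  I = ⟨ (λ q → T (init q)) ⟩
  F = ⟨ (λ q → T (Buchi.acc A q)) ⟩

  open Step F

  ⟨⟩-mono : ∀ {P Q : Fin n → Set} → (∀ {q} → P q → Q q) → ⟨ P ⟩ ⊆ ⟨ Q ⟩
  ⟨⟩-mono P⇒Q q∈ = ∈⟨⟩⁺ (P⇒Q (∈⟨⟩⁻ q∈))

  Edge : Fin s → Vec ℤ β → Vec ℤ β → Fin n → Fin n → Set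
  Edge a z z' p q = ∃ λ t → t ∈ δ × Trans.src t ≡ p × Trans.tgt t ≡ q × Trans.lab t ≡ a
    × T (eval (Trans.con t) z z')

  edges : Fin s → Vec ℤ β → Vec ℤ β → Edges n
  edges a z z' = tabulate λ p → ⟨ Edge a z z' p ⟩

  edge⁺ : ∀ {a z z' p q} → Edge a z z' p q → q ∈ₛ lookup (edges a z z') p
  edge⁺ {p = p} {q} e = subst (q ∈ₛ_) (sym (Vecₚ.lookup∘tabulate _ p)) (∈⟨⟩⁺ e)

  edge⁻ : ∀ {a z z' p q} → q ∈ₛ lookup (edges a z z') p → Edge a z z' p q
  edge⁻ {p = p} {q} q∈ = ∈⟨⟩⁻ (subst (q ∈ₛ_) (Vecₚ.lookup∘tabulate _ p) q∈)

  Edge-agree : ∀ {a z z' y y' p q} → codeOf z z' ≡ codeOf y y' → Edge a z z' p q → Edge a y y' p q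
  Edge-agree {z = z} {z'} {y} {y'} same (t , t∈ , src≡ , tgt≡ , lab≡ , h) =
    t , t∈ , src≡ , tgt≡ , lab≡ , subst T (Agree.eval-agree {z} {z'} {y} {y'} same (Trans.con t)
      (proj₁ (involves t t∈)) (λ d d∈ → let d∈ds = proj₂ (involves t t∈) d d∈ in
        head-≤ ds increasing d∈ds , ≤-last ds increasing d∈ds)) h

  edges-agree : ∀ {a z z' y y'} → codeOf z z' ≡ codeOf y y' → edges a z z' ≡ edges a y y'
  edges-agree same = Vecₚ.tabulate-cong λ p →
    ⊆-antisym (⟨⟩-mono (Edge-agree same)) (⟨⟩-mono (Edge-agree (sym same)))

  step : Edges n → State → State
  step E S = greens E (family S) ∷ bads E (family S) ∷ next E (family S)

  initial : State
  initial = ∅ ∷ ∅ ∷ collect (∅ ∷ I ∷ [])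

  nQ' : ℕ
  nQ' = (2 ^ n) ^ (3 + n)

  target : Fin nQ' → Fin s → Vec ℤ β → Vec ℤ β → Fin nQ'
  target q a z z' = encode (step (edges a z z') (decode q))

  -- The target is computed from an arbitrary valuation of the type; by edges-agree all
  -- valuations of the same type yield the same target.
  move : Fin nQ' × Fin s × Code → Maybe (Trans nQ' s β)
  move (q , a , c) with em {P = Satisfiable (constraint c)}
  ... | yes (z , z' , _) = just (trans q a (constraint c) (target q a z z'))
  ... | no _             = nothing

  sources : List (Fin nQ' × Fin s × Code)
  sources = cartesianProduct (allFin nQ') (cartesianProduct (allFin s) codes)

  δ' : List (Trans nQ' s β)
  δ' = mapMaybe move sources

  record Moves (t : Trans nQ' s β) : Set where
    field
      code     : Code
      code∈    : code ∈ codes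
      con≡     : Trans.con t ≡ constraint code
      sat      : Satisfiable (constraint code)
      tgt≡     : Trans.tgt t ≡ target (Trans.src t) (Trans.lab t) (proj₁ sat) (proj₁ (proj₂ sat))
      move≡    : move (Trans.src t , Trans.lab t , code) ≡ just t

  move-just : ∀ q a c {t} → move (q , a , c) ≡ just t → Σ (Satisfiable (constraint c)) λ sat →
    t ≡ trans q a (constraint c) (target q a (proj₁ sat) (proj₁ (proj₂ sat)))
  move-just q a c p≡ with em {P = Satisfiable (constraint c)}
  move-just q a c refl | yes sat = sat , refl

  ∈δ'⁻ : ∀ {t} → t ∈ δ' → Moves t
  ∈δ'⁻ {t} t∈ with ∈-mapMaybe⁻ move {sources} t∈
  ... | (q , a , c) , qac∈ , p≡ with move-just q a c p≡
  ...   | sat , refl = record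
    { code = c ; code∈ = c∈ ; con≡ = refl ; sat = sat ; tgt≡ = refl ; move≡ = p≡ }
    where
    c∈ : c ∈ codes
    c∈ = proj₂ (∈-cartesianProduct⁻ (allFin s) codes
           (proj₂ (∈-cartesianProduct⁻ (allFin nQ') (cartesianProduct (allFin s) codes) qac∈)))

  -- The valuation itself shows that its type is satisfiable, so the automaton is complete and every
  -- word has a run.
  move-enabled : ∀ q a z z' → ∃ λ t → t ∈ δ' × Trans.src t ≡ q × Trans.lab t ≡ a
    × T (eval (Trans.con t) z z')
  move-enabled q a z z' = found (enabled (z , z' , constraint-codeOf z z'))
    where
    enabled : Satisfiable (constraint (codeOf z z')) → ∃ λ r →
      move (q , a , codeOf z z') ≡ just (trans q a (constraint (codeOf z z')) r)
    enabled h with em {P = Satisfiable (constraint (codeOf z z'))}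
    ... | yes (y , y' , _) = target q a y y' , refl
    ... | no ¬h            = ⊥-elim (¬h h)
    found : (∃ λ r → move (q , a , codeOf z z') ≡ just (trans q a (constraint (codeOf z z')) r)) → _
    found (r , p≡) = trans q a (constraint (codeOf z z')) r
      , ∈-mapMaybe⁺ move (∈-cartesianProduct⁺ (∈-allFin q)
          (∈-cartesianProduct⁺ (∈-allFin a) (codeOf-∈ z z'))) p≡
      , refl , refl , constraint-codeOf z z'

  code-of-move : ∀ {t} (m : Moves t) z z' → T (eval (Trans.con t) z z') → Moves.code m ≡ codeOf z z'
  code-of-move m z z' h = code-unique code∈ z z' (subst (λ Θ → T (eval Θ z z')) con≡ h)
    where open Moves m

  move-target : ∀ {t} → t ∈ δ' → ∀ z z' → T (eval (Trans.con t) z z') →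
    Trans.tgt t ≡ target (Trans.src t) (Trans.lab t) z z'
  move-target {t} t∈ z z' h = ≡.trans tgt≡ (cong (λ E → encode (step E (decode (Trans.src t))))
    (edges-agree (≡.trans (sym (code-unique code∈ _ _ (proj₂ (proj₂ sat)))) (code-of-move m z z' h))))
    where
    m = ∈δ'⁻ t∈
    open Moves m

  aut' : CA s β
  aut' = record { nQ = nQ' ; init = λ q → ⌊ q Finₚ.≟ encode initial ⌋ ; δ = δ' }

  -- The valuation fixes the code, and `move` is a function of source, letter and code.
  deterministic : Deterministic aut'
  deterministic t u t∈ u∈ z z' src≡ lab≡ ht hu = just-injective (≡.trans (sym (Moves.move≡ mt))
    (≡.trans (cong move (cong₂ _,_ src≡ (cong₂ _,_ lab≡
      (≡.trans (code-of-move mt z z' ht) (sym (code-of-move mu z z' hu)))))) (Moves.move≡ mu)))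
    where
    mt = ∈δ'⁻ t∈
    mu = ∈δ'⁻ u∈

  pair : Fin n → (Fin nQ' → Bool) × (Fin nQ' → Bool)
  pair k = (λ q → lookup (greenFlags (decode q)) k) , (λ q → lookup (badFlags (decode q)) k)

  rabin : Rabin s β
  rabin = record { aut = aut' ; pairs = List.map pair (allFin n) }

  -- Equality of the languages

  module _ (w : Word s β) where

    E : ℕ → Edges n
    E i = edges (letter w i) (vals w i) (vals w (suc i))

    open Runs em I F E using (fam; BüchiRun; RabinRun; sound; complete)

    states : ℕ → State
    states zero    = initial
    states (suc i) = step (E i) (states i)

    states-fam : ∀ i → family (states i) ≡ fam i
    states-fam zero    = refl
    states-fam (suc i) = cong (next (E i)) (states-fam i)

    büchi⇒ : AcceptsB A w → BüchiRun
    büchi⇒ (r , often) = loc , ∈⟨⟩⁺ start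
      , (λ i → edge⁺ (ρ i , inδ i , refl , chain i , label i , sat i))
      , λ N → let i , N≤i , f = often N in i , N≤i , ∈⟨⟩⁺ f
      where open Run r

    büchi⇐ : BüchiRun → AcceptsB A w
    büchi⇐ (ρ , ρ0∈I , ρ-edge , often) = record
      { ρ     = λ i → proj₁ (e i)
      ; inδ   = λ i → proj₁ (proj₂ (e i))
      ; start = subst (λ q → T (init q)) (sym (src 0)) (∈⟨⟩⁻ ρ0∈I)
      ; chain = λ i → ≡.trans (proj₁ (proj₂ (proj₂ (proj₂ (e i))))) (sym (src (suc i)))
      ; label = λ i → proj₁ (proj₂ (proj₂ (proj₂ (proj₂ (e i)))))
      ; sat   = λ i → proj₂ (proj₂ (proj₂ (proj₂ (proj₂ (e i)))))
      } , λ N → let i , N≤i , f = often N in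
        i , N≤i , subst (λ q → T (Buchi.acc A q)) (sym (src i)) (∈⟨⟩⁻ f)
      where
      e : ∀ i → Edge (letter w i) (vals w i) (vals w (suc i)) (ρ i) (ρ (suc i))
      e i = edge⁻ (ρ-edge i)
      src : ∀ i → Trans.src (proj₁ (e i)) ≡ ρ i
      src i = proj₁ (proj₂ (proj₂ (e i)))

    module Flags {q i} (q≡ : q ≡ encode (states (suc i))) where

      decode≡ : decode q ≡ states (suc i)
      decode≡ = ≡.trans (cong decode q≡) (decode-encode (states (suc i)))

      green≡ : greenFlags (decode q) ≡ greens (E i) (fam i)
      green≡ = ≡.trans (cong greenFlags decode≡) (cong (greens (E i)) (states-fam i))

      bad≡ : badFlags (decode q) ≡ bads (E i) (fam i)
      bad≡ = ≡.trans (cong badFlags decode≡) (cong (bads (E i)) (states-fam i))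

    rabin⇒ : AcceptsR rabin w → RabinRun
    rabin⇒ (r , LU , LU∈ , inf , fin) with ∈-map⁻ pair LU∈
    ... | k , _ , refl = k , greens-often , proj₁ fin , bads-rare
      where
      open Run r
      loc≡ : ∀ i → loc i ≡ encode (states i)
      loc≡ zero    = toWitness start
      loc≡ (suc i) = ≡.trans (sym (chain i)) (≡.trans (move-target (inδ i) _ _ (sat i))
        (cong₂ (λ a S → encode (step (edges a (vals w i) (vals w (suc i))) S)) (label i)
          (≡.trans (cong decode (loc≡ i)) (decode-encode (states i)))))
      greens-often : ∀ N → ∃ λ i → N ≤ i × k ∈ₛ greens (E i) (fam i)
      -- The flags of step `i` are stored in state `suc i`; the bound `suc N` skips the initial
      -- state, whose flags come from no step.
      greens-often N with inf (suc N)
      ... | suc i , s≤s N≤i , t = i , N≤i ,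
        subst (k ∈ₛ_) (Flags.green≡ (loc≡ (suc i))) (Equivalence.from ∈⇔T t)
      bads-rare : ∀ i → proj₁ fin ≤ i → k ∉ₛ bads (E i) (fam i)
      bads-rare i N≤i = subst (k ∉ₛ_) (Flags.bad≡ (loc≡ (suc i)))
        (Equivalence.from ∉⇔Tnot (proj₂ fin (suc i) (ℕₚ.m≤n⇒m≤1+n N≤i)))

    rabin⇐ : RabinRun → AcceptsR rabin w
    rabin⇐ (k , often , N , rare) = run , pair k , ∈-map⁺ pair (∈-allFin k) , inf , suc N , fin
      where
      m : ∀ i → ∃ λ t → t ∈ δ' × Trans.src t ≡ encode (states i) × Trans.lab t ≡ letter w i
        × T (eval (Trans.con t) (vals w i) (vals w (suc i)))
      m i = move-enabled (encode (states i)) (letter w i) (vals w i) (vals w (suc i))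
      src : ∀ i → Trans.src (proj₁ (m i)) ≡ encode (states i)
      src i = proj₁ (proj₂ (proj₂ (m i)))
      tgt : ∀ i → Trans.tgt (proj₁ (m i)) ≡ encode (states (suc i))
      tgt i = ≡.trans (move-target (proj₁ (proj₂ (m i))) _ _ (proj₂ (proj₂ (proj₂ (proj₂ (m i))))))
        (cong₂ (λ a S → encode (step (edges a (vals w i) (vals w (suc i))) S))
          (proj₁ (proj₂ (proj₂ (proj₂ (m i)))))
          (≡.trans (cong decode (src i)) (decode-encode (states i))))
      run : Run aut' w
      run = record
        { ρ     = λ i → proj₁ (m i)
        ; inδ   = λ i → proj₁ (proj₂ (m i))
        ; start = fromWitness (src 0)
        ; chain = λ i → ≡.trans (tgt i) (sym (src (suc i)))
        ; label = λ i → proj₁ (proj₂ (proj₂ (proj₂ (m i))))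
        ; sat   = λ i → proj₂ (proj₂ (proj₂ (proj₂ (m i))))
        }
      inf : InfOften (Run.loc run) (proj₁ (pair k))
      inf M = let i , M≤i , k∈ = often M in suc i , ℕₚ.m≤n⇒m≤1+n M≤i ,
        Equivalence.to ∈⇔T (subst (k ∈ₛ_) (sym (Flags.green≡ (src (suc i)))) k∈)
      fin : ∀ i → suc N ≤ i → T (not (proj₂ (pair k) (Run.loc run i)))
      fin (suc i) (s≤s N≤i) =
        Equivalence.to ∉⇔Tnot (subst (k ∉ₛ_) (sym (Flags.bad≡ (src (suc i)))) (rare i N≤i))

    accepts⇔ : AcceptsB A w ⇔ AcceptsR rabin w
    accepts⇔ = mk⇔ (λ acc → rabin⇐ (complete (büchi⇒ acc))) (λ acc → büchi⇐ (sound (rabin⇒ acc)))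

  pairs-bound : length (Rabin.pairs rabin) ≤ 2 * n
  pairs-bound = ℕₚ.≤-trans (ℕₚ.≤-reflexive (≡.trans (Listₚ.length-map pair (allFin n))
    (Listₚ.length-tabulate {n = n} (λ i → i)))) (ℕₚ.m≤m+n n _)

  con-bound : ∀ t → t ∈ δ' → InSatTypes (head ds) (last ds) (Trans.con t)
    × size (Trans.con t) ≤ 29 * suc (paramN β (head ds) (last ds)) ^ 3
  con-bound t t∈ = (toType code , wellFormed code∈ , con≡ , subst Satisfiable (sym con≡) sat)
    , subst (λ Θ → size Θ ≤ _) (sym con≡) (constraint-size code∈)
    where open Moves (∈δ'⁻ t∈)

  -- Source, letter and code determine a transition, so a single factor `nQ'` arises, which is at
  -- most its square.
  δ'-bound : length δ' ≤ nQ' ^ 2 * s * (∣ last ds - head ds ∣ + 3) ^ (2 * β) * 3 ^ (2 * (β * β))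
  δ'-bound = begin
    length δ'
      ≤⟨ Listₚ.length-mapMaybe move sources ⟩
    length sources
      ≡⟨ length-cartesianProductWith _,_ (allFin nQ') (cartesianProduct (allFin s) codes) ⟩
    length (allFin nQ') * length (cartesianProduct (allFin s) codes)
      ≡⟨ cong₂ _*_ (length-allFin nQ') (≡.trans (length-cartesianProductWith _,_ (allFin s) codes)
           (cong (_* length codes) (length-allFin s))) ⟩
    nQ' * (s * length codes)
      ≤⟨ ℕₚ.*-mono-≤ square (ℕₚ.*-monoʳ-≤ s length-codes) ⟩
    nQ' ^ 2 * (s * (C * D))
      ≡⟨ reassoc (nQ' ^ 2) s C D ⟩
    nQ' ^ 2 * s * C * D ∎
    where
    open ℕₚ.≤-Reasoning
    C D : ℕ
    C = (∣ last ds - head ds ∣ + 3) ^ (2 * β)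
    D = 3 ^ (2 * (β * β))
    m≤m² : ∀ m → m ≤ m ^ 2
    m≤m² zero    = z≤n
    m≤m² (suc m) = ℕₚ.m≤m*n (suc m) (suc m * 1)
    square : nQ' ≤ nQ' ^ 2
    square = m≤m² nQ'
    reassoc : ∀ m s C D → m * (s * (C * D)) ≡ m * s * C * D
    reassoc = solve-∀

theorem7p2 : ExcludedMiddle 0ℓ →
    ∃[ c ] (∀ {s β k} (ds : Vec ℤ (suc k)) → StrictlyIncreasing ds →
    (A : Buchi s β) → Involves ds (Buchi.aut A) →
    Σ (Rabin s β) λ A' →
    Deterministic (Rabin.aut A')
    × SameLanguage A A'
    × CA.nQ (Rabin.aut A') ≤ 2 ^ (c * suc (CA.nQ (Buchi.aut A)) ^ c)
    × length (Rabin.pairs A') ≤ 2 * CA.nQ (Buchi.aut A)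
    × (∀ t → t ∈ CA.δ (Rabin.aut A') →
    InSatTypes (head ds) (last ds) (Trans.con t)
    × size (Trans.con t) ≤ c * suc (paramN β (head ds) (last ds)) ^ 3)
    × length (CA.δ (Rabin.aut A'))
    ≤ CA.nQ (Rabin.aut A') ^ 2 * s
    * (∣ last ds - head ds ∣ + 3) ^ (2 * β) * 3 ^ (2 * (β * β)))
-- The value 29 is dictated by `constraint-size`; for the number of states 3 would do.
theorem7p2 em = 29 , λ ds increasing A involves → let open Determinise em ds increasing A involves in
  rabin , deterministic , accepts⇔ , states-≤ (CA.nQ (Buchi.aut A)) 29 (s≤s (s≤s (s≤s z≤n)))
  , pairs-bound , con-bound , δ'-bound
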